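{- Consider the classification problem with categorical observations described in the context. \begin{enumerate} \item For any $\epsilon\in(0,1)$, there is a 1-pass streaming algorithm that finds a partition $[N]=A\sqcup B$ with $L(A,B)\le\mathrm{OPT}+\epsilon$ using $\tilde{O}(N/\epsilon)$ memory, $O(1)$ update time and $O(2^N)$ post-processing time. \item Any constant-pass streaming algorithm that decides whether $\mathrm{OPT}=0$ requires $\Omega(N)$ space. \end{enumerate}
   Context: Let $[N]=\{1,\dots,N\}$, regarded as a set of categories with no meaningful order. The input is a data stream of $m$ pairs $(x_1,y_1),\dots,(x_m,y_m)$ with $x_i\in[N]$ and $y_i\in\{ -1,+1\}$. For $R\subseteq[N]$ and $u\in\{ -1,+1\}$ let $f_{u,R}=\sum_{i=1}^m[x_i\in R][y_i=u]$. For a partition $[N]=A\sqcup B$ into two disjoint sets, the misclassification rate is $L(A,B)=\frac1m\big(\min\{f_{ -1,A},f_{+1,A}\}+\min\{f_{ -1,B},f_{+1,B}\}\big)$, and $\mathrm{OPT}=\min_{A\sqcup B=[N]}L(A,B)$. $\tilde{O}(\cdot)$ suppresses $\mathrm{polylog}(N)$ or $\mathrm{polylog}(m)$ factors. Streaming algorithms may be randomized (deciding correctly with probability at least $2/3$). -}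

module Defs where

open import Data.Bool using (Bool; true; false; if_then_else_)
open import Data.Fin using (Fin; toℕ)
open import Data.Fin.Subset using (Subset; Side; inside; outside; ∁)
open import Data.Fin.Subset.Properties using (_∈?_)
import Data.Integer as ℤ
open import Data.List as List using (List)
open import Data.List.NonEmpty as List⁺ using (List⁺; _∷_; toList)
open import Data.Maybe using (Maybe; just; nothing)
open import Data.Nat
  using (ℕ; zero; suc; _+_; _*_; _∸_; _^_; _⊓_; _<_; _<?_; NonZero)
open import Data.Nat.DivMod using (_mod_)
open import Data.Nat.Logarithm using (⌊log₂_⌋)
open import Data.Nat.Properties using (m^n≢0)
open import Data.Product using (_×_; _,_)
open import Data.Rational as ℚ using (ℚ; 0ℚ; _/_)
import Data.Rational.Properties as ℚ
open import Data.Sign as Sign using (Sign)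
import Data.Sign.Properties as Sign
open import Data.Vec as Vec using (Vec; []; _∷_; lookup; tabulate; replicate)
open import Level using (0ℓ)
open import Relation.Binary.PropositionalEquality using (_≡_)
open import Relation.Nullary using (does)
open import Relation.Nullary.Decidable using (⌊_⌋; _×-dec_)
open import Relation.Unary using (Pred; Decidable)

fromℕ : ℕ → ℚ
fromℕ n = ℤ.+ n / 1

vectors : {A : Set} → List⁺ A → ∀ n → List⁺ (Vec A n)
vectors as zero    = [] ∷ List.[]
vectors as (suc n) =
  List⁺.concatMap (λ a → List⁺.map (a ∷_) (vectors as n)) as

------------------------------------------------------------------------
-- Classification of categorical observations

Observation : ℕ → Set
Observation N = Fin N × Sign

Stream : ℕ → ℕ → Set
Stream N m = Vec (Observation N) m

freq : ∀ {N m} → Sign → Subset N → Stream N m → ℕ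
freq u R = Vec.count λ (x , y) → (x ∈? R) ×-dec (y Sign.≟ u)

-- The partition [N] = A ⊔ B is given by A, with B = ∁ A; either side may
-- be empty.
L : ∀ {N m} .{{_ : NonZero m}} → Stream N m → Subset N → ℚ
L {m = m} xs A =
  ℤ.+ ( (freq Sign.- A xs ⊓ freq Sign.+ A xs)
      + (freq Sign.- (∁ A) xs ⊓ freq Sign.+ (∁ A) xs)) / m

partitions : ∀ N → List⁺ (Subset N)
partitions = vectors (inside ∷ outside List.∷ List.[])

OPT : ∀ {N m} .{{_ : NonZero m}} → Stream N m → ℚ
OPT {N} xs = List⁺.foldr₁ ℚ._⊓_ (List⁺.map (L xs) (partitions N))

------------------------------------------------------------------------
-- Streaming algorithms

Word : ℕ → Set
Word w = Fin (2 ^ w)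

-- s words of w bits each, that is, s * w bits.
Memory : ℕ → ℕ → Set
Memory w s = Vec (Word w) s

-- Only what is kept between consecutive observations is charged as space:
-- the computation inside `step` is unrestricted, and the number of the
-- current pass and the position in the stream are known for free.
record Deterministic (X Y : Set) (m passes w s : ℕ) : Set where
  field
    init   : Memory w s
    step   : Fin passes → Fin m → X → Memory w s → Memory w s
    output : Memory w s → Y

  pass : Vec X m → Memory w s → Fin passes → Memory w s
  pass xs mem j =
    List.foldl (λ mem′ i → step j i (lookup xs i) mem′) mem (List.allFin m)

  run : Vec X m → Y
  run xs = output (List.foldl (pass xs) init (List.allFin passes))

open Deterministic public using (run)

-- A randomized algorithm is a deterministic one drawn uniformly from a
-- finite multiset; the random choice is not charged as space.
Randomized : (X Y : Set) (m passes w s : ℕ) → Set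
Randomized X Y m passes w s = List⁺ (Deterministic X Y m passes w s)

Pr : {A : Set} {P : Pred A 0ℓ} → List⁺ A → Decidable P → ℚ
Pr as P? = ℤ.+ List.length (List.filter P? (toList as)) / List⁺.length as

WithinError : ∀ {N m passes w s} .{{_ : NonZero m}} →
              Randomized (Observation N) (Subset N) m passes w s → ℚ → Set
WithinError {N} {m} 𝒜 ε = (xs : Stream N m) →
  ℤ.+ 2 / 3 ℚ.≤ Pr 𝒜 (λ alg → L xs (run alg xs) ℚ.≤? (OPT xs ℚ.+ ε))

DecidesOPT≡0 : ∀ {N m passes w s} .{{_ : NonZero m}} →
               Randomized (Observation N) Bool m passes w s → Set
DecidesOPT≡0 {N} {m} 𝒜 = (xs : Stream N m) →
  ℤ.+ 2 / 3 ℚ.≤ Pr 𝒜 (λ alg → run alg xs Bool.≟ ⌊ OPT xs ℚ.≟ 0ℚ ⌋)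
  where import Data.Bool as Bool

------------------------------------------------------------------------
-- Word RAM with coin flips

-- Operands are addresses of cells, except in `set` (an immediate value) and
-- for the targets of jumps (positions in the program).
data Instruction : Set where
  set   : (dst value : ℕ) → Instruction
  add   : (dst a b : ℕ) → Instruction
  sub   : (dst a b : ℕ) → Instruction
  load  : (dst ptr : ℕ) → Instruction
  store : (ptr src : ℕ) → Instruction
  flip  : (dst : ℕ) → Instruction
  jump  : (target : ℕ) → Instruction
  jlt   : (a b target : ℕ) → Instruction

Code : Set
Code = List Instruction

-- The output is the set of those x for which cell base + x is nonzero.
record Program : Set where
  field
    update : Code
    post   : Code
    base   : ℕ

module RAM (w : ℕ) where

  word : ℕ → Word w
  word n = _mod_ n (2 ^ w) {{m^n≢0 2 w}}

  -- Reading outside the memory gives 0, writing there has no effect.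
  read : ∀ {s} → Memory w s → ℕ → ℕ
  read []       _       = 0
  read (v ∷ _)  zero    = toℕ v
  read (_ ∷ vs) (suc a) = read vs a

  write : ∀ {s} → Memory w s → ℕ → ℕ → Memory w s
  write []       _       _ = []
  write (_ ∷ vs) zero    n = word n ∷ vs
  write (v ∷ vs) (suc a) n = v ∷ write vs a n

  record Config (s : ℕ) : Set where
    constructor config
    field
      pc  : ℕ
      mem : Memory w s

  open Config public

  -- Falling or jumping off the code halts the machine.
  fetch : Code → ℕ → Maybe Instruction
  fetch code n = List.head (List.drop n code)

  execute : ∀ {s} → Bool → Instruction → Config s → Config s
  execute coin instr (config n μ) = go instr
    where
    put : ℕ → ℕ → Config _
    put dst v = config (suc n) (write μ dst v)

    go : Instruction → Config _
    go (set dst v)    = put dst v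
    go (add dst a b)  = put dst (read μ a + read μ b)
    go (sub dst a b)  = put dst (read μ a + (2 ^ w ∸ read μ b))
    go (load dst ptr) = put dst (read μ (read μ ptr))
    go (store ptr a)  = put (read μ ptr) (read μ a)
    go (flip dst)     = put dst (if coin then 1 else 0)
    go (jump t)       = config t μ
    go (jlt a b t)    = config (if does (read μ a <? read μ b) then t else suc n) μ

  -- Each time step comes with a fresh coin, so the length of the vector of
  -- coins is the number of time steps.
  steps : ∀ {s t} → Code → Vec Bool t → Config s → Config s
  steps code []       c = c
  steps code (b ∷ bs) c with fetch code (pc c)
  ... | nothing    = c
  ... | just instr = steps code bs (execute b instr c)

  exec : ∀ {s t} → Code → Vec Bool t → Memory w s → Config s
  exec code coins μ = steps code coins (config 0 μ)

  HaltsWithin : ∀ {s} → ℕ → Code → Memory w s → Set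
  HaltsWithin t code μ =
    (coins : Vec Bool t) → fetch code (pc (exec code coins μ)) ≡ nothing

  -- Cell 0 initially holds N; everything else is 0.
  start : ∀ s → ℕ → Memory w s
  start s N = write (replicate s (word 0)) 0 N

  -- An observation (x , y) is placed in cells 1 and 2, with x counted from 0.
  receive : ∀ {N s} → Observation N → Memory w s → Memory w s
  receive (x , y) μ = write (write μ 1 (toℕ x)) 2 (label y)
    where
    label : Sign → ℕ
    label Sign.- = 0
    label Sign.+ = 1

  selected : ∀ {s} N → ℕ → Memory w s → Subset N
  selected N base μ = tabulate λ x → does (0 <? read μ (base + toℕ x))

module _ (P : Program) (N m w s : ℕ) where
  open Program P
  open RAM w

  -- The memory contents that can arise after a given number of updates,
  -- each allotted t time steps.
  data Reachable (t : ℕ) : ℕ → Memory w s → Set where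
    initial : Reachable t 0 (start s N)
    next    : ∀ {i μ} → Reachable t i μ →
              (obs : Observation N) (coins : Vec Bool t) →
              Reachable t (suc i) (mem (exec update coins (receive obs μ)))

  UpdateTime : ℕ → Set
  UpdateTime t = ∀ {i μ} → i < m → Reachable t i μ →
    (obs : Observation N) → HaltsWithin t update (receive obs μ)

  -- t is the time allotted to each update, T the time for post-processing.
  PostTime : ℕ → ℕ → Set
  PostTime t T = ∀ {μ} → Reachable t m μ → HaltsWithin T post μ

  module _ (t T : ℕ) where

    coinTosses : ∀ n → List⁺ (Vec Bool n)
    coinTosses = vectors (true ∷ false List.∷ List.[])

    withCoins : Vec (Vec Bool t) m → Vec Bool T →
                Deterministic (Observation N) (Subset N) m 1 w s
    withCoins tosses final = record
      { init   = start s N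
      ; step   = λ _ i obs μ → mem (exec update (lookup tosses i) (receive obs μ))
      ; output = λ μ → selected N base (mem (exec post final μ))
      }

    -- The 1-pass streaming algorithm carried out by the program, when updates
    -- take time t and post-processing takes time T.
    onePass : Randomized (Observation N) (Subset N) m 1 w s
    onePass =
      List⁺.concatMap (λ tosses → List⁺.map (withCoins tosses) (coinTosses T))
                      (vectors (coinTosses t) m)

------------------------------------------------------------------------
-- Asymptotics

polylog : ℕ → ℕ → ℕ → ℕ
polylog k N m = ((1 + ⌊log₂ N ⌋) * (1 + ⌊log₂ m ⌋)) ^ k

-- Θ(log (N + m)) bits, the usual word size of a word RAM.
wordSize : ℕ → ℕ → ℕ → ℕ
wordSize c N m = c * (1 + ⌊log₂ (N + m) ⌋)

{-# OPTIONS --safe #-}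

-- Upper bound: the errors of a partition split over the categories, so
-- m · OPT = Σ_x min (#(x,-), #(x,+)), attained by the set of categories with a
-- positive majority. Two counters per category (Boyer–Moore style cancellation)
-- maintain this set exactly, without randomness or post-processing.
--
-- Lower bound: OPT = 0 says that the categories seen with label - and those seen
-- with label + are disjoint, so passes over a stream solve set disjointness, and
-- a pass is two messages. Public bits z decide who may own which coordinate;
-- Alice holds x ∩ z and Bob y ∩ ∁ z, except that a random coordinate i is forced
-- to be absent from both sets, or present in both. In a rectangle of inputs let
-- a₀, a₁ (b₀, b₁) count Alice's (Bob's) inputs with i absent, present. Then
--   a₀ b₀ ≤ a₁ b₁ + b₀ (a₀ ∸ a₁) + a₀ (b₀ ∸ b₁),
-- and as a₀, a₁, b₀ do not change when i is moved into z, the first error term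
-- becomes a sum over i of biases of a set of points of the cube, which a Chernoff
-- bound makes small unless the set is exponentially small. Summing over the
-- 2^(2 · passes · s · w) rectangles of memory histories, the acceptance
-- probabilities of the two kinds of inputs differ by less than 1/3.
module Submission where

open import Defs

open import Algebra.Properties.CommutativeSemigroup using (interchange)
open import Data.Bool using (Bool; true; false; not; _∧_; if_then_else_; T)
import Data.Bool.Properties as Bool
open import Data.Empty using (⊥)
open import Data.Fin as Fin using (Fin; zero; suc; toℕ; _↑ˡ_; _↑ʳ_)
import Data.Fin.Properties as Fin
open import Data.Fin.Subset using (Subset; inside; outside; _∩_; ∁)
open import Data.Fin.Subset.Properties using (_∈?_)
import Data.Integer as ℤ
import Data.Integer.Properties as ℤ
open import Data.List as List using (List; []; _∷_; _++_; concatMap; allFin; length)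
import Data.List.Membership.Propositional as List
import Data.List.Membership.Propositional.Properties as List
open import Data.List.NonEmpty as List⁺ using (List⁺; _∷_; toList)
import Data.List.Properties as List
import Data.List.Relation.Unary.All as ListAll
import Data.List.Relation.Unary.All.Properties as ListAll
open import Data.List.Relation.Unary.Any using (here; there)
open import Data.Maybe using (just; nothing)
open import Data.Nat hiding (_/_)
open import Data.Nat.DivMod using (m<n⇒m%n≡m; m%n<n; [m+n]%n≡m%n)
open import Data.Nat.ListAction using (sum)
open import Data.Nat.ListAction.Properties using (sum-++)
open import Data.Nat.Logarithm using (⌊log₂_⌋; ⌊log₂⌋-mono-≤; ⌊log₂[2^n]⌋≡n)
open import Data.Nat.Properties
open import Data.Nat.Tactic.RingSolver using (solve-∀)
open import Data.Product using (_×_; _,_; proj₁; proj₂; Σ-syntax; ∃-syntax)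
open import Data.Rational as ℚ using (ℚ; 0ℚ; 1ℚ; _/_)
import Data.Rational.Properties as ℚ
open import Data.Rational.Unnormalised as ℚᵘ using (mkℚᵘ; *≤*)
import Data.Rational.Unnormalised.Properties as ℚᵘ
open import Data.Sign as Sign using (Sign)
import Data.Sign.Properties as Sign
open import Data.Sum using (_⊎_; inj₁; inj₂)
open import Data.Vec as Vec using (Vec; []; _∷_; lookup; _[_]≔_)
open import Data.Vec.Membership.Propositional using (_∈_)
import Data.Vec.Membership.Propositional.Properties as Vec
import Data.Vec.Properties as Vec
open import Data.Vec.Relation.Unary.All using (All; []; _∷_)
import Data.Vec.Relation.Unary.All.Properties as All
open import Data.Vec.Relation.Unary.Any using (here; there)
open import Function using (_∘_; id; case_of_; Equivalence)
open import Level using (0ℓ)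
open import Relation.Binary.Definitions using (DecidableEquality)
open import Relation.Binary.PropositionalEquality
open import Relation.Nullary using (Dec; yes; no; does; contradiction)
open import Relation.Nullary.Decidable using (⌊_⌋; dec-true; dec-false; isYes≗does)
open import Relation.Unary using (Pred; Decidable)

-- Publishing z makes Alice's and Bob's inputs independent, so that the counts over a rectangle are
-- products; this is what the inequality between a₀ b₀ and a₁ b₁ needs. The budget, with n = L n′:
-- each of the two error terms of a rectangle costs at most 4 (n′ · `mass` + n · 4^n · tail). The
-- rectangles are disjoint, so their masses add up to at most 8^n and cost 8 n′ 8^n, out of n 8^n
-- questions in all. Only the tail is paid once per rectangle, and it is chosen so small that all
-- rectangles together add at most another 8 n′ 8^n. The sum is the fraction 16/L. For the tail, the
-- base (k+1)/k gives a fraction of about exp(-n′/k + n/(2k²)), which is least at k = L. A block of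
-- L · K coordinates then halves it as soon as K exceeds about 2 L ln 2, roughly 68 for L = 49.

private variable
  A B : Set
  n N m : ℕ

-- Finite sums

⟦_⟧ : Bool → ℕ
⟦ b ⟧ = if b then 1 else 0

⟦⟧≤1 : ∀ b → ⟦ b ⟧ ≤ 1
⟦⟧≤1 true  = ≤-refl
⟦⟧≤1 false = z≤n

⟦⟧*-≤ : ∀ b {c d} → (T b → c ≤ d) → ⟦ b ⟧ * c ≤ d
⟦⟧*-≤ true  c≤d = ≤-trans (≤-reflexive (*-identityˡ _)) (c≤d _)
⟦⟧*-≤ false c≤d = z≤n

⟦∧⟧ : ∀ b c → ⟦ b ∧ c ⟧ ≡ ⟦ b ⟧ * ⟦ c ⟧
⟦∧⟧ true  c = sym (*-identityˡ ⟦ c ⟧)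
⟦∧⟧ false c = refl

∑ : List A → (A → ℕ) → ℕ
∑ xs f = sum (List.map f xs)

infix 5 ∑
syntax ∑ xs (λ x → e) = ∑[ x ∈ xs ] e

∑-cong : ∀ (xs : List A) {f g : A → ℕ} → (∀ x → f x ≡ g x) → ∑ xs f ≡ ∑ xs g
∑-cong xs f≗g = cong sum (List.map-cong f≗g xs)

∑-mono : ∀ (xs : List A) {f g : A → ℕ} → (∀ x → f x ≤ g x) → ∑ xs f ≤ ∑ xs g
∑-mono []       f≤g = z≤n
∑-mono (x ∷ xs) f≤g = +-mono-≤ (f≤g x) (∑-mono xs f≤g)

∑-distrib-+ : ∀ (xs : List A) (f g : A → ℕ) → (∑[ x ∈ xs ] (f x + g x)) ≡ ∑ xs f + ∑ xs g
∑-distrib-+ []       f g = refl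
∑-distrib-+ (x ∷ xs) f g =
  trans (cong (f x + g x +_) (∑-distrib-+ xs f g)) (interchange +-commutativeSemigroup (f x) (g x) _ _)

*-distribˡ-∑ : ∀ c (xs : List A) (f : A → ℕ) → c * ∑ xs f ≡ ∑[ x ∈ xs ] c * f x
*-distribˡ-∑ c []       f = *-zeroʳ c
*-distribˡ-∑ c (x ∷ xs) f =
  trans (*-distribˡ-+ c (f x) _) (cong (c * f x +_) (*-distribˡ-∑ c xs f))

*-distribʳ-∑ : ∀ c (xs : List A) (f : A → ℕ) → ∑ xs f * c ≡ ∑[ x ∈ xs ] f x * c
*-distribʳ-∑ c xs f =
  trans (*-comm (∑ xs f) c) (trans (*-distribˡ-∑ c xs f) (∑-cong xs λ x → *-comm c (f x)))

∑-const : ∀ (xs : List A) c → (∑[ x ∈ xs ] c) ≡ length xs * c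
∑-const []       c = refl
∑-const (x ∷ xs) c = cong (c +_) (∑-const xs c)

∑-≤-const : ∀ (xs : List A) {f c} → (∀ x → f x ≤ c) → ∑ xs f ≤ length xs * c
∑-≤-const xs f≤c = ≤-trans (∑-mono xs f≤c) (≤-reflexive (∑-const xs _))

∑-zero : ∀ (xs : List A) → (∑[ x ∈ xs ] 0) ≡ 0
∑-zero xs = trans (∑-const xs 0) (*-zeroʳ (length xs))

∑-comm : ∀ (xs : List A) (ys : List B) (f : A → B → ℕ) →
         (∑[ x ∈ xs ] ∑[ y ∈ ys ] f x y) ≡ (∑[ y ∈ ys ] ∑[ x ∈ xs ] f x y)
∑-comm []       ys f = sym (∑-zero ys)
∑-comm (x ∷ xs) ys f =
  trans (cong (∑ ys (f x) +_) (∑-comm xs ys f)) (sym (∑-distrib-+ ys (f x) _))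

∑-* : ∀ (xs : List A) (ys : List B) (f : A → ℕ) (g : B → ℕ) →
      ∑ xs f * ∑ ys g ≡ (∑[ x ∈ xs ] ∑[ y ∈ ys ] f x * g y)
∑-* xs ys f g = trans (*-distribʳ-∑ (∑ ys g) xs f) (∑-cong xs λ x → *-distribˡ-∑ (f x) ys g)

∑-map : ∀ (h : A → B) xs (f : B → ℕ) → ∑ (List.map h xs) f ≡ ∑ xs (f ∘ h)
∑-map h xs f = cong sum (sym (List.map-∘ xs))

∑-++ : ∀ (xs ys : List A) (f : A → ℕ) → ∑ (xs ++ ys) f ≡ ∑ xs f + ∑ ys f
∑-++ xs ys f = trans (cong sum (List.map-++ f xs ys)) (sum-++ (List.map f xs) _)

∑-concatMap : ∀ (h : A → List B) xs (f : B → ℕ) →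
              ∑ (concatMap h xs) f ≡ (∑[ x ∈ xs ] ∑ (h x) f)
∑-concatMap h []       f = refl
∑-concatMap h (x ∷ xs) f =
  trans (∑-++ (h x) _ f) (cong (∑ (h x) f +_) (∑-concatMap h xs f))

∑-allFin : ∀ n (f : Fin (suc n) → ℕ) → ∑ (allFin (suc n)) f ≡ f zero + ∑ (allFin n) (f ∘ suc)
∑-allFin n f = cong (f zero +_)
  (trans (cong (λ xs → ∑ xs f) (sym (List.map-tabulate id suc))) (∑-map suc (allFin n) f))

length-allFin : ∀ n → length (allFin n) ≡ n
length-allFin n = List.length-tabulate id

length-concatMap : ∀ (h : A → List B) xs {k} → (∀ x → length (h x) ≡ k) →
                     length (concatMap h xs) ≡ length xs * k
length-concatMap h []       eq = refl
length-concatMap h (x ∷ xs) eq =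
  trans (List.length-++ (h x)) (cong₂ _+_ (eq x) (length-concatMap h xs eq))

-- Enumerating vectors and the Boolean cube

vecs : List A → ∀ n → List (Vec A n)
vecs as zero    = [] ∷ []
vecs as (suc n) = concatMap (λ a → List.map (a ∷_) (vecs as n)) as

∑-vecs : ∀ (as : List A) n (f : Vec A (suc n) → ℕ) →
         ∑ (vecs as (suc n)) f ≡ (∑[ a ∈ as ] ∑[ v ∈ vecs as n ] f (a ∷ v))
∑-vecs as n f =
  trans (∑-concatMap (λ a → List.map (a ∷_) (vecs as n)) as f)
        (∑-cong as λ a → ∑-map (a ∷_) (vecs as n) f)

length-vecs : ∀ (as : List A) n → length (vecs as n) ≡ length as ^ n
length-vecs as zero    = refl
length-vecs as (suc n) = length-concatMap (λ a → List.map (a ∷_) (vecs as n)) as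
  λ a → trans (List.length-map (a ∷_) (vecs as n)) (length-vecs as n)

bits : ∀ n → List (Vec Bool n)
bits = vecs (false ∷ true ∷ [])

length-bits : ∀ n → length (bits n) ≡ 2 ^ n
length-bits = length-vecs _

∑-bits : ∀ n (f : Vec Bool (suc n) → ℕ) →
         ∑ (bits (suc n)) f ≡ ∑ (bits n) (f ∘ (false ∷_)) + ∑ (bits n) (f ∘ (true ∷_))
∑-bits n f = trans (∑-vecs _ n f)
  (cong (∑ (bits n) (f ∘ (false ∷_)) +_) (+-identityʳ (∑ (bits n) (f ∘ (true ∷_)))))

∑-bits-not : ∀ n (f : Vec Bool n → ℕ) → ∑ (bits n) (f ∘ Vec.map not) ≡ ∑ (bits n) f
∑-bits-not zero    f = refl
∑-bits-not (suc n) f = begin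
  ∑ (bits (suc n)) (f ∘ Vec.map not)  ≡⟨ ∑-bits n _ ⟩
  ∑ (bits n) (f ∘ (true ∷_) ∘ Vec.map not) + ∑ (bits n) (f ∘ (false ∷_) ∘ Vec.map not)
    ≡⟨ cong₂ _+_ (∑-bits-not n (f ∘ (true ∷_))) (∑-bits-not n (f ∘ (false ∷_))) ⟩
  ∑ (bits n) (f ∘ (true ∷_)) + ∑ (bits n) (f ∘ (false ∷_))  ≡⟨ +-comm (∑ (bits n) (f ∘ (true ∷_))) _ ⟩
  ∑ (bits n) (f ∘ (false ∷_)) + ∑ (bits n) (f ∘ (true ∷_))  ≡⟨ ∑-bits n f ⟨
  ∑ (bits (suc n)) f  ∎
  where open ≡-Reasoning

-- Overwriting coordinate i maps the cube two-to-one onto the half where that coordinate is b.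
∑-bits-set : ∀ (i : Fin n) b (f : Vec Bool n → ℕ) →
             (∑[ x ∈ bits n ] f (x [ i ]≔ b)) ≡
             2 * (∑[ x ∈ bits n ] ⟦ does (lookup x i Bool.≟ b) ⟧ * f x)
∑-bits-set {suc n} zero b f = begin
  ∑[ x ∈ bits (suc n) ] f (x [ zero ]≔ b)  ≡⟨ ∑-bits n _ ⟩
  S + S  ≡⟨ cong (S +_) (+-identityʳ S) ⟨
  2 * S  ≡⟨ cong (2 *_) (lemma b) ⟩
  2 * (∑ (bits n) (g ∘ (false ∷_)) + ∑ (bits n) (g ∘ (true ∷_)))  ≡⟨ cong (2 *_) (∑-bits n g) ⟨
  2 * ∑ (bits (suc n)) g ∎
  where
  open ≡-Reasoning
  S = ∑[ x ∈ bits n ] f (b ∷ x)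
  g : Vec Bool (suc n) → ℕ
  g x = ⟦ does (lookup x zero Bool.≟ b) ⟧ * f x
  lemma : ∀ b → (∑[ x ∈ bits n ] f (b ∷ x)) ≡
    (∑[ x ∈ bits n ] ⟦ does (false Bool.≟ b) ⟧ * f (false ∷ x)) +
    (∑[ x ∈ bits n ] ⟦ does (true Bool.≟ b) ⟧ * f (true ∷ x))
  lemma true  = cong₂ _+_ (sym (∑-zero (bits n))) (∑-cong (bits n) λ x → sym (*-identityˡ _))
  lemma false = trans (∑-cong (bits n) λ x → sym (*-identityˡ _))
    (trans (sym (+-identityʳ _)) (cong ((∑[ x ∈ bits n ] 1 * f (false ∷ x)) +_) (sym (∑-zero (bits n)))))
∑-bits-set {suc n} (suc i) b f = begin
  ∑[ x ∈ bits (suc n) ] f (x [ suc i ]≔ b)  ≡⟨ ∑-bits n _ ⟩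
  (∑[ x ∈ bits n ] f (false ∷ x [ i ]≔ b)) + (∑[ x ∈ bits n ] f (true ∷ x [ i ]≔ b))
    ≡⟨ cong₂ _+_ (∑-bits-set i b (f ∘ (false ∷_))) (∑-bits-set i b (f ∘ (true ∷_))) ⟩
  2 * G₀ + 2 * G₁  ≡⟨ *-distribˡ-+ 2 G₀ G₁ ⟨
  2 * (G₀ + G₁)    ≡⟨ cong (2 *_) (∑-bits n g) ⟨
  2 * ∑ (bits (suc n)) g ∎
  where
  open ≡-Reasoning
  g : Vec Bool (suc n) → ℕ
  g x = ⟦ does (lookup x (suc i) Bool.≟ b) ⟧ * f x
  G₀ = ∑ (bits n) (g ∘ (false ∷_))
  G₁ = ∑ (bits n) (g ∘ (true ∷_))

-- A Chernoff bound by counting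

hits : Bool → Vec Bool n → Vec Bool n → ℕ
hits {n} b ι x = ∑[ i ∈ allFin n ] ⟦ lookup ι i ⟧ * ⟦ does (lookup x i Bool.≟ b) ⟧

hits-∷ : ∀ b c d (ι x : Vec Bool n) →
         hits b (c ∷ ι) (d ∷ x) ≡ ⟦ c ⟧ * ⟦ does (d Bool.≟ b) ⟧ + hits b ι x
hits-∷ {n} b c d ι x = ∑-allFin n _

hits≤n : ∀ b (ι x : Vec Bool n) → hits b ι x ≤ n
hits≤n {n} b ι x = begin
  hits b ι x              ≤⟨ ∑-≤-const (allFin n) (λ i → *-mono-≤ (⟦⟧≤1 (lookup ι i)) (⟦⟧≤1 (does (lookup x i Bool.≟ b)))) ⟩
  length (allFin n) * 1   ≡⟨ *-identityʳ _ ⟩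
  length (allFin n)       ≡⟨ length-allFin n ⟩
  n                       ∎
  where open ≤-Reasoning

^-distribʳ-* : ∀ q a b → (a * b) ^ q ≡ a ^ q * b ^ q
^-distribʳ-* zero    a b = refl
^-distribʳ-* (suc q) a b =
  trans (cong (a * b *_) (^-distribʳ-* q a b)) ([m*n]*[o*p]≡[m*o]*[n*p] a b (a ^ q) (b ^ q))

skewed : ℕ → Vec Bool n → Vec Bool n → Bool
skewed n′ ι x = hits true ι x + n′ <ᵇ hits false ι x

-- An exponential-moment bound: the weights are those of ((k+1)/k)^(zeros − ones),
-- cleared of denominators.
module Chernoff (k : ℕ) .{{_ : NonZero k}} where

  weight₁ : Bool → Bool → ℕ
  weight₁ true  false = suc k * suc k
  weight₁ true  true  = k * k
  weight₁ false _     = k * suc k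

  weight : Vec Bool n → Vec Bool n → ℕ
  weight []      []      = 1
  weight (c ∷ ι) (d ∷ x) = weight₁ c d * weight ι x

  -- This is `weight` = (k (k+1))^n · ((k+1)/k)^(zeros - ones), multiplied out because the exponent
  -- may be negative.
  weight-hits : ∀ (ι x : Vec Bool n) →
    weight ι x * (suc k ^ hits true ι x * k ^ hits false ι x) ≡
    (k * suc k) ^ n * (suc k ^ hits false ι x * k ^ hits true ι x)
  weight-hits []      []      = refl
  weight-hits {suc n} (c ∷ ι) (d ∷ x)
    rewrite hits-∷ true c d ι x | hits-∷ false c d ι x = step c d
    where
    p = hits true ι x
    q = hits false ι x
    W = weight ι x
    D = (k * suc k) ^ n
    step : ∀ c d → weight₁ c d * W *
        (suc k ^ (⟦ c ⟧ * ⟦ does (d Bool.≟ true) ⟧ + p) * k ^ (⟦ c ⟧ * ⟦ does (d Bool.≟ false) ⟧ + q)) ≡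
        k * suc k * D *
        (suc k ^ (⟦ c ⟧ * ⟦ does (d Bool.≟ false) ⟧ + q) * k ^ (⟦ c ⟧ * ⟦ does (d Bool.≟ true) ⟧ + p))
    step false d = trans (*-assoc (k * suc k) W _)
      (trans (cong (k * suc k *_) (weight-hits ι x)) (sym (*-assoc (k * suc k) D _)))
    step true true = trans (lemma k (suc k) W (suc k ^ p) (k ^ q))
      (trans (cong (k * suc k * k *_) (weight-hits ι x)) (sym (lemma′ k (suc k) D (suc k ^ q) (k ^ p))))
      where
      lemma : ∀ k l W a b → k * k * W * (l * a * b) ≡ k * l * k * (W * (a * b))
      lemma = solve-∀
      lemma′ : ∀ k l D a b → k * l * D * (a * (k * b)) ≡ k * l * k * (D * (a * b))
      lemma′ = solve-∀
    step true false = trans (lemma k (suc k) W (suc k ^ p) (k ^ q))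
      (trans (cong (k * suc k * suc k *_) (weight-hits ι x)) (sym (lemma′ k (suc k) D (suc k ^ q) (k ^ p))))
      where
      lemma : ∀ k l W a b → l * l * W * (a * (k * b)) ≡ k * l * l * (W * (a * b))
      lemma = solve-∀
      lemma′ : ∀ k l D a b → k * l * D * (l * a * b) ≡ k * l * l * (D * (a * b))
      lemma′ = solve-∀

  mean : ℕ
  mean = suc k * suc k + k * k

  -- The sum factors over the coordinates. One in ι contributes exactly `mean`; one outside ι
  -- contributes 2k(k+1), which is `mean` less one.
  ∑-weight : ∀ (ι : Vec Bool n) → ∑ (bits n) (weight ι) ≤ mean ^ n
  ∑-weight []              = ≤-refl
  ∑-weight {suc n} (c ∷ ι) = begin
    ∑ (bits (suc n)) (weight (c ∷ ι))  ≡⟨ ∑-bits n _ ⟩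
    (∑[ x ∈ bits n ] weight₁ c false * weight ι x) + (∑[ x ∈ bits n ] weight₁ c true * weight ι x)
      ≡⟨ cong₂ _+_ (*-distribˡ-∑ (weight₁ c false) (bits n) _) (*-distribˡ-∑ (weight₁ c true) (bits n) _) ⟨
    weight₁ c false * S + weight₁ c true * S  ≡⟨ *-distribʳ-+ S (weight₁ c false) _ ⟨
    (weight₁ c false + weight₁ c true) * S    ≤⟨ *-mono-≤ (step c) (∑-weight ι) ⟩
    mean * mean ^ n ∎
    where
    open ≤-Reasoning
    S = ∑ (bits n) (weight ι)
    step : ∀ c → weight₁ c false + weight₁ c true ≤ mean
    step true  = ≤-refl
    step false = ≤-trans (n≤1+n _) (≤-reflexive (lemma k))
      where
      lemma : ∀ k → 1 + (k * (1 + k) + k * (1 + k)) ≡ (1 + k) * (1 + k) + k * k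
      lemma = solve-∀

  -- With p ones and p + n′ + e zeros over ι, `weight-hits` gives the bound up to the excess e,
  -- which only helps since k ≤ k + 1. The powers common to both sides are nonzero and cancel.
  weight-skewed : ∀ n′ (ι x : Vec Bool n) → hits true ι x + n′ ≤ hits false ι x →
                  (k * suc k) ^ n * suc k ^ n′ ≤ k ^ n′ * weight ι x
  weight-skewed {n} n′ ι x le with m≤n⇒∃[o]m+o≡n le
  ... | e , eq = *-cancelʳ-≤ _ _ (k ^ e * (k ^ p * suc k ^ p)) {{nz}} (begin
    D * suc k ^ n′ * (k ^ e * (k ^ p * suc k ^ p))
      ≤⟨ *-monoʳ-≤ (D * suc k ^ n′) (*-monoˡ-≤ (k ^ p * suc k ^ p) (^-monoˡ-≤ e (n≤1+n k))) ⟩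
    D * suc k ^ n′ * (suc k ^ e * (k ^ p * suc k ^ p))
      ≡⟨ lemma D (suc k ^ n′) (suc k ^ e) (k ^ p) (suc k ^ p) ⟩
    D * (suc k ^ p * suc k ^ n′ * suc k ^ e * k ^ p)
      ≡⟨ cong (λ z → D * (z * k ^ p)) (sym (pow (suc k))) ⟩
    D * (suc k ^ q * k ^ p)   ≡⟨ weight-hits ι x ⟨
    W * (suc k ^ p * k ^ q)   ≡⟨ cong (λ z → W * (suc k ^ p * z)) (pow k) ⟩
    W * (suc k ^ p * (k ^ p * k ^ n′ * k ^ e))
      ≡⟨ lemma′ W (suc k ^ p) (k ^ p) (k ^ n′) (k ^ e) ⟩
    k ^ n′ * W * (k ^ e * (k ^ p * suc k ^ p)) ∎)
    where
    open ≤-Reasoning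
    p = hits true ι x
    q = hits false ι x
    W = weight ι x
    D = (k * suc k) ^ n
    nz : NonZero (k ^ e * (k ^ p * suc k ^ p))
    nz = m*n≢0 _ _ {{m^n≢0 k e}} {{m*n≢0 _ _ {{m^n≢0 k p}} {{m^n≢0 (suc k) p}}}}
    pow : ∀ b → b ^ q ≡ b ^ p * b ^ n′ * b ^ e
    pow b = trans (cong (b ^_) (sym eq)) (trans (^-distribˡ-+-* b (p + n′) e)
      (cong (_* b ^ e) (^-distribˡ-+-* b p n′)))
    lemma : ∀ D a b c d → D * a * (b * (c * d)) ≡ D * (d * a * b * c)
    lemma = solve-∀
    lemma′ : ∀ W a b c d → W * (a * (b * c * d)) ≡ c * W * (d * (b * a))
    lemma′ = solve-∀

  -- Markov's inequality for `weight ι`.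
  #skewed : ∀ n′ (ι : Vec Bool n) →
    (∑[ x ∈ bits n ] ⟦ skewed n′ ι x ⟧) * ((k * suc k) ^ n * suc k ^ n′) ≤ k ^ n′ * mean ^ n
  #skewed {n} n′ ι = begin
    (∑[ x ∈ bits n ] ⟦ skewed n′ ι x ⟧) * T₀    ≡⟨ *-distribʳ-∑ T₀ (bits n) _ ⟩
    ∑[ x ∈ bits n ] ⟦ skewed n′ ι x ⟧ * T₀      ≤⟨ ∑-mono (bits n) pointwise ⟩
    ∑[ x ∈ bits n ] k ^ n′ * weight ι x          ≡⟨ *-distribˡ-∑ (k ^ n′) (bits n) _ ⟨
    k ^ n′ * ∑ (bits n) (weight ι)               ≤⟨ *-monoʳ-≤ (k ^ n′) (∑-weight ι) ⟩
    k ^ n′ * mean ^ n ∎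
    where
    open ≤-Reasoning
    T₀ = (k * suc k) ^ n * suc k ^ n′
    pointwise : ∀ x → ⟦ skewed n′ ι x ⟧ * T₀ ≤ k ^ n′ * weight ι x
    pointwise x = ⟦⟧*-≤ (skewed n′ ι x) λ lt → weight-skewed n′ ι x (<⇒≤ (<ᵇ⇒< _ _ lt))

  -- The numerical condition says that K blocks of L coordinates halve the tail.
  #skewed-blocks : ∀ L K →
    2 * (k ^ K * mean ^ (L * K)) ≤ 2 ^ (L * K) * ((k * suc k) ^ (L * K) * suc k ^ K) →
    ∀ q (ι : Vec Bool (L * (K * q))) →
    (∑[ x ∈ bits (L * (K * q)) ] ⟦ skewed (K * q) ι x ⟧) * 2 ^ q ≤ 2 ^ (L * (K * q))
  #skewed-blocks L K cond q ι = *-cancelʳ-≤ _ _ (X ^ q) {{m^n≢0 X q {{nzX}}}} (begin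
    S * 2 ^ q * X ^ q     ≡⟨ xy S (2 ^ q) (X ^ q) ⟩
    2 ^ q * (S * X ^ q)   ≡⟨ cong (λ z → 2 ^ q * (S * z)) X^q ⟩
    2 ^ q * (S * ((k * suc k) ^ n₀ * suc k ^ (K * q)))  ≤⟨ *-monoʳ-≤ (2 ^ q) (#skewed (K * q) ι) ⟩
    2 ^ q * (k ^ (K * q) * mean ^ n₀)  ≡⟨ cong (2 ^ q *_) Y^q ⟨
    2 ^ q * Y ^ q         ≡⟨ ^-distribʳ-* q 2 Y ⟨
    (2 * Y) ^ q           ≤⟨ ^-monoˡ-≤ q cond ⟩
    (2 ^ (L * K) * X) ^ q ≡⟨ ^-distribʳ-* q (2 ^ (L * K)) X ⟩
    (2 ^ (L * K)) ^ q * X ^ q ≡⟨ cong (_* X ^ q) (pow 2) ⟩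
    2 ^ n₀ * X ^ q ∎)
    where
    open ≤-Reasoning
    n₀ = L * (K * q)
    S = ∑[ x ∈ bits n₀ ] ⟦ skewed (K * q) ι x ⟧
    X = (k * suc k) ^ (L * K) * suc k ^ K
    Y = k ^ K * mean ^ (L * K)
    nzX : NonZero X
    nzX = m*n≢0 _ _ {{m^n≢0 (k * suc k) (L * K) {{m*n≢0 k (suc k)}}}} {{m^n≢0 (suc k) K}}
    xy : ∀ a b c → a * b * c ≡ b * (a * c)
    xy = solve-∀
    pow : ∀ b → (b ^ (L * K)) ^ q ≡ b ^ n₀
    pow b = trans (^-*-assoc b (L * K) q) (cong (b ^_) (*-assoc L K q))
    X^q : X ^ q ≡ (k * suc k) ^ n₀ * suc k ^ (K * q)
    X^q = trans (^-distribʳ-* q _ (suc k ^ K)) (cong₂ _*_ (pow (k * suc k)) (^-*-assoc (suc k) K q))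
    Y^q : Y ^ q ≡ k ^ (K * q) * mean ^ n₀
    Y^q = trans (^-distribʳ-* q (k ^ K) _) (cong₂ _*_ (^-*-assoc k K q) (pow mean))

-- The acceptance gap will come out as 16/L, so L = 49 is the least L with 16/L < 1/3;
-- k = 49 and K = 70 then meet the numerical condition.
few-skewed : ∀ q (ι : Vec Bool (49 * (70 * q))) →
    (∑[ x ∈ bits (49 * (70 * q)) ] ⟦ skewed (70 * q) ι x ⟧) * 2 ^ q ≤ 2 ^ (49 * (70 * q))
few-skewed = Chernoff.#skewed-blocks 49 49 70 (≤ᵇ⇒≤ _ _ _)

-- Corruption of rectangles

count : Bool → (Vec Bool n → ℕ) → Fin n → ℕ
count {n} b φ i = ∑[ x ∈ bits n ] ⟦ does (lookup x i Bool.≟ b) ⟧ * φ x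

-- The truncated difference is the true one where b < a and 0 elsewhere. Moving b to the left avoids
-- subtraction, so that the two terms can later be summed separately.
∸-threshold : ∀ a b → a ∸ b + ⟦ b <ᵇ a ⟧ * b ≤ ⟦ b <ᵇ a ⟧ * a
∸-threshold a b with b <ᵇ a in eq
... | true  = ≤-reflexive (trans (cong (a ∸ b +_) (*-identityˡ b))
  (trans (m∸n+n≡m (<⇒≤ (<ᵇ⇒< b a (Equivalence.from Bool.T-≡ eq)))) (sym (*-identityˡ a))))
... | false = ≤-reflexive (trans (+-identityʳ (a ∸ b))
  (m≤n⇒m∸n≡0 {a} {b} (≮⇒≥ λ lt → subst T eq (<⇒<ᵇ lt))))

-- Summing over the coordinates ι where 0 prevails exchanges the deficits for
-- the surplus of zeros of a single point over ι, which is small off the tail.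
∑-deficit : ∀ {tail} n′ → (∀ (ι : Vec Bool n) → (∑[ x ∈ bits n ] ⟦ skewed n′ ι x ⟧) ≤ tail) →
            (φ : Vec Bool n → ℕ) → (∀ x → φ x ≤ 1) →
            (∑[ i ∈ allFin n ] (count false φ i ∸ count true φ i)) ≤ n′ * ∑ (bits n) φ + n * tail
∑-deficit {n} {tail} n′ few φ φ≤1 = +-cancelʳ-≤ (∑ (bits n) λ x → hits true ι x * φ x) _ _ (begin
  ∑ (allFin n) (λ i → c₀ i ∸ c₁ i) + ∑ (bits n) (λ x → hits true ι x * φ x)
    ≡⟨ cong (∑ (allFin n) (λ i → c₀ i ∸ c₁ i) +_) (exchange true) ⟨
  ∑ (allFin n) (λ i → c₀ i ∸ c₁ i) + ∑ (allFin n) (λ i → ⟦ lookup ι i ⟧ * c₁ i)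
    ≡⟨ ∑-distrib-+ (allFin n) _ _ ⟨
  ∑[ i ∈ allFin n ] (c₀ i ∸ c₁ i + ⟦ lookup ι i ⟧ * c₁ i)
    ≤⟨ ∑-mono (allFin n) threshold ⟩
  ∑[ i ∈ allFin n ] ⟦ lookup ι i ⟧ * c₀ i   ≡⟨ exchange false ⟩
  ∑[ x ∈ bits n ] hits false ι x * φ x      ≤⟨ ∑-mono (bits n) bound ⟩
  ∑[ x ∈ bits n ] (n′ * φ x + n * ⟦ skewed n′ ι x ⟧ + hits true ι x * φ x)
    ≡⟨ ∑-distrib-+ (bits n) _ _ ⟩
  (∑[ x ∈ bits n ] (n′ * φ x + n * ⟦ skewed n′ ι x ⟧)) + H
    ≡⟨ cong (_+ H) (∑-distrib-+ (bits n) _ _) ⟩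
  (∑[ x ∈ bits n ] n′ * φ x) + (∑[ x ∈ bits n ] n * ⟦ skewed n′ ι x ⟧) + H
    ≡⟨ cong (_+ H) (cong₂ _+_ (*-distribˡ-∑ n′ (bits n) φ) (*-distribˡ-∑ n (bits n) _)) ⟨
  n′ * ∑ (bits n) φ + n * (∑[ x ∈ bits n ] ⟦ skewed n′ ι x ⟧) + H
    ≤⟨ +-monoˡ-≤ H (+-monoʳ-≤ (n′ * ∑ (bits n) φ) (*-monoʳ-≤ n (few ι))) ⟩
  n′ * ∑ (bits n) φ + n * tail + H ∎)
  where
  open ≤-Reasoning
  c₀ = count false φ
  c₁ = count true φ
  ι : Vec Bool n
  ι = Vec.tabulate λ i → c₁ i <ᵇ c₀ i
  H = ∑[ x ∈ bits n ] hits true ι x * φ x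
  threshold : ∀ i → c₀ i ∸ c₁ i + ⟦ lookup ι i ⟧ * c₁ i ≤ ⟦ lookup ι i ⟧ * c₀ i
  threshold i rewrite Vec.lookup∘tabulate (λ i → c₁ i <ᵇ c₀ i) i = ∸-threshold (c₀ i) (c₁ i)
  exchange : ∀ b → (∑[ i ∈ allFin n ] ⟦ lookup ι i ⟧ * count b φ i) ≡ (∑[ x ∈ bits n ] hits b ι x * φ x)
  exchange b = begin-equality
    ∑[ i ∈ allFin n ] ⟦ lookup ι i ⟧ * count b φ i
      ≡⟨ ∑-cong (allFin n) (λ i → trans (*-distribˡ-∑ ⟦ lookup ι i ⟧ (bits n) _)
           (∑-cong (bits n) λ x → sym (*-assoc ⟦ lookup ι i ⟧ _ (φ x)))) ⟩
    ∑[ i ∈ allFin n ] ∑[ x ∈ bits n ] ⟦ lookup ι i ⟧ * ⟦ does (lookup x i Bool.≟ b) ⟧ * φ x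
      ≡⟨ ∑-comm (allFin n) (bits n) _ ⟩
    ∑[ x ∈ bits n ] ∑[ i ∈ allFin n ] ⟦ lookup ι i ⟧ * ⟦ does (lookup x i Bool.≟ b) ⟧ * φ x
      ≡⟨ ∑-cong (bits n) (λ x → *-distribʳ-∑ (φ x) (allFin n) _) ⟨
    ∑[ x ∈ bits n ] hits b ι x * φ x ∎
  -- Off the tail the zeros over ι exceed the ones by at most n′; on the tail the trivial bound n is
  -- paid.
  hits-bound : ∀ x → hits false ι x ≤ n′ + n * ⟦ skewed n′ ι x ⟧ + hits true ι x
  hits-bound x with skewed n′ ι x in eq
  ... | true  = ≤-trans (hits≤n false ι x) (≤-trans (≤-reflexive (sym (*-identityʳ n)))
                  (≤-trans (m≤n+m (n * 1) n′) (m≤m+n _ _)))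
  ... | false = ≤-trans (≮⇒≥ λ lt → subst T eq (<⇒<ᵇ lt)) (≤-reflexive
                  (trans (+-comm (hits true ι x) n′) (cong (_+ hits true ι x)
                    (sym (trans (cong (n′ +_) (*-zeroʳ n)) (+-identityʳ n′))))))
  bound : ∀ x → hits false ι x * φ x ≤ n′ * φ x + n * ⟦ skewed n′ ι x ⟧ + hits true ι x * φ x
  bound x = begin
    hits false ι x * φ x   ≤⟨ *-monoˡ-≤ (φ x) (hits-bound x) ⟩
    (n′ + s + hits true ι x) * φ x  ≡⟨ *-distribʳ-+ (φ x) (n′ + s) _ ⟩
    (n′ + s) * φ x + hits true ι x * φ x ≡⟨ cong (_+ hits true ι x * φ x) (*-distribʳ-+ (φ x) n′ s) ⟩
    n′ * φ x + s * φ x + hits true ι x * φ x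
      ≤⟨ +-monoˡ-≤ _ (+-monoʳ-≤ (n′ * φ x) (≤-trans (*-monoʳ-≤ s (φ≤1 x)) (≤-reflexive (*-identityʳ s)))) ⟩
    n′ * φ x + s + hits true ι x * φ x ∎
    where s = n * ⟦ skewed n′ ι x ⟧

-- Masked and pinned inputs

∁-involutive : ∀ (z : Vec Bool n) → ∁ (∁ z) ≡ z
∁-involutive z = trans (sym (Vec.map-∘ not not z)) (trans (Vec.map-cong Bool.not-involutive z) (Vec.map-id z))

∩-update : ∀ (x z : Vec Bool n) i b c → (x [ i ]≔ b) ∩ (z [ i ]≔ c) ≡ (x ∩ z) [ i ]≔ (b ∧ c)
∩-update (_ ∷ _) (_ ∷ _) zero    b c = refl
∩-update (d ∷ x) (e ∷ z) (suc i) b c = cong (d ∧ e ∷_) (∩-update x z i b c)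

update-id : ∀ (x : Vec Bool n) i {b} → lookup x i ≡ b → x [ i ]≔ b ≡ x
update-id x i refl = Vec.[]≔-lookup x i

masked : (Vec Bool n → Bool) → Vec Bool n → ℕ
masked {n} f z = ∑[ x ∈ bits n ] ⟦ f (x ∩ z) ⟧

-- With f Alice's side of a rectangle, b = false and b = true give the a₀ and a₁ of the overview;
-- with Bob's side and `∁ z` they give b₀ and b₁.
pinned : (Vec Bool n → Bool) → Bool → Vec Bool n → Fin n → ℕ
pinned {n} f b z i = ∑[ x ∈ bits n ] ⟦ f ((x ∩ z) [ i ]≔ b) ⟧

-- Bit i of z only influences bit i of the input, and that one is overwritten.
pinned-update : ∀ (f : Vec Bool n → Bool) b c z i → pinned f b (z [ i ]≔ c) i ≡ pinned f b z i
pinned-update {n} f b c z i = ∑-cong (bits n) λ x → cong (⟦_⟧ ∘ f) (begin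
  (x ∩ (z [ i ]≔ c)) [ i ]≔ b                        ≡⟨ cong (λ y → (y ∩ (z [ i ]≔ c)) [ i ]≔ b) (Vec.[]≔-lookup x i) ⟨
  ((x [ i ]≔ lookup x i) ∩ (z [ i ]≔ c)) [ i ]≔ b    ≡⟨ cong (_[ i ]≔ b) (∩-update x z i _ c) ⟩
  (x ∩ z) [ i ]≔ (lookup x i ∧ c) [ i ]≔ b           ≡⟨ Vec.[]≔-idempotent (x ∩ z) i ⟩
  (x ∩ z) [ i ]≔ b                                   ∎)
  where open ≡-Reasoning

pinned-outside : ∀ (f : Vec Bool n → Bool) z i → lookup z i ≡ false → pinned f false z i ≡ masked f z
pinned-outside {n} f z i eq = ∑-cong (bits n) λ x → cong (⟦_⟧ ∘ f)
  (update-id (x ∩ z) i (trans (Vec.lookup-zipWith _∧_ i x z)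
    (trans (cong (lookup x i ∧_) eq) (Bool.∧-zeroʳ (lookup x i)))))

-- If z contains i, pinning may be done on x before masking, and by `∑-bits-set` every x with the
-- right bit is then met twice.
pinned-inside : ∀ (f : Vec Bool n → Bool) b z i → lookup z i ≡ true →
                pinned f b z i ≡ 2 * count b (λ x → ⟦ f (x ∩ z) ⟧) i
pinned-inside {n} f b z i eq = trans
  (∑-cong (bits n) λ x → cong (⟦_⟧ ∘ f) (begin
    (x ∩ z) [ i ]≔ b               ≡⟨ cong ((x ∩ z) [ i ]≔_) (Bool.∧-identityʳ b) ⟨
    (x ∩ z) [ i ]≔ (b ∧ true)      ≡⟨ ∩-update x z i b true ⟨
    (x [ i ]≔ b) ∩ (z [ i ]≔ true) ≡⟨ cong ((x [ i ]≔ b) ∩_) (update-id z i eq) ⟩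
    (x [ i ]≔ b) ∩ z               ∎))
  (∑-bits-set i b λ x → ⟦ f (x ∩ z) ⟧)
  where
  open ≡-Reasoning

-- Counts the questions whose inputs of kind b land in the rectangle f × g. Given i and z the two
-- inputs are independent, hence the product.
agreement : (f g : Vec Bool n → Bool) → Bool → ℕ
agreement {n} f g b = ∑[ i ∈ allFin n ] ∑[ z ∈ bits n ] pinned f b z i * pinned g b (∁ z) i

-- The error term b₀ (a₀ ∸ a₁). The other one, a₀ (b₀ ∸ b₁), is `loss g f i (∁ z)`.
loss : (f g : Vec Bool n → Bool) → Fin n → Vec Bool n → ℕ
loss f g i z = pinned g false (∁ z) i * (pinned f false z i ∸ pinned f true z i)

-- Counts the triples (z, x, y) that land in the rectangle when no coordinate is forced.
mass : (f g : Vec Bool n → Bool) → ℕ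
mass {n} f g = ∑[ z ∈ bits n ] masked f z * masked g (∁ z)

mass-sym : ∀ (f g : Vec Bool n → Bool) → mass f g ≡ mass g f
mass-sym {n} f g = trans (sym (∑-bits-not n _)) (∑-cong (bits n) λ z →
  trans (*-comm (masked f (∁ z)) _) (cong (λ y → masked g y * masked f (∁ z)) (∁-involutive z)))

-- Lowering a₀ to its minimum with a₁ costs b₀ (a₀ ∸ a₁); then lowering b₀ to its minimum with b₁
-- costs at most a₀ (b₀ ∸ b₁). What is left is at most a₁ b₁.
product-loss : ∀ a₀ a₁ b₀ b₁ → a₀ * b₀ ≤ a₁ * b₁ + b₀ * (a₀ ∸ a₁) + a₀ * (b₀ ∸ b₁)
product-loss a₀ a₁ b₀ b₁ with ≤-total a₀ a₁ | ≤-total b₀ b₁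
... | inj₁ p | inj₁ q = ≤-trans (*-mono-≤ p q) (≤-trans (m≤m+n _ _) (m≤m+n _ _))
... | inj₂ p | inj₁ q = begin
  a₀ * b₀                      ≡⟨ cong (_* b₀) (m+[n∸m]≡n p) ⟨
  (a₁ + (a₀ ∸ a₁)) * b₀        ≡⟨ trans (*-distribʳ-+ b₀ a₁ _) (cong (a₁ * b₀ +_) (*-comm (a₀ ∸ a₁) b₀)) ⟩
  a₁ * b₀ + b₀ * (a₀ ∸ a₁)     ≤⟨ +-monoˡ-≤ _ (*-monoʳ-≤ a₁ q) ⟩
  a₁ * b₁ + b₀ * (a₀ ∸ a₁)     ≤⟨ m≤m+n _ _ ⟩
  a₁ * b₁ + b₀ * (a₀ ∸ a₁) + a₀ * (b₀ ∸ b₁) ∎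
  where open ≤-Reasoning
... | inj₁ p | inj₂ q = begin
  a₀ * b₀                      ≡⟨ cong (a₀ *_) (m+[n∸m]≡n q) ⟨
  a₀ * (b₁ + (b₀ ∸ b₁))        ≡⟨ *-distribˡ-+ a₀ b₁ _ ⟩
  a₀ * b₁ + a₀ * (b₀ ∸ b₁)     ≤⟨ +-monoˡ-≤ _ (≤-trans (*-monoˡ-≤ b₁ p) (m≤m+n _ _)) ⟩
  a₁ * b₁ + b₀ * (a₀ ∸ a₁) + a₀ * (b₀ ∸ b₁) ∎
  where open ≤-Reasoning
... | inj₂ p | inj₂ q = begin
  a₀ * b₀                      ≡⟨ cong (_* b₀) (m+[n∸m]≡n p) ⟨
  (a₁ + (a₀ ∸ a₁)) * b₀        ≡⟨ trans (*-distribʳ-+ b₀ a₁ _) (cong (a₁ * b₀ +_) (*-comm (a₀ ∸ a₁) b₀)) ⟩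
  a₁ * b₀ + b₀ * (a₀ ∸ a₁)     ≡⟨ cong (λ b → a₁ * b + b₀ * (a₀ ∸ a₁)) (m+[n∸m]≡n q) ⟨
  a₁ * (b₁ + (b₀ ∸ b₁)) + b₀ * (a₀ ∸ a₁) ≡⟨ shuffle a₁ b₁ (b₀ ∸ b₁) (b₀ * (a₀ ∸ a₁)) ⟩
  a₁ * b₁ + b₀ * (a₀ ∸ a₁) + a₁ * (b₀ ∸ b₁) ≤⟨ +-monoʳ-≤ (a₁ * b₁ + b₀ * (a₀ ∸ a₁)) (*-monoˡ-≤ (b₀ ∸ b₁) p) ⟩
  a₁ * b₁ + b₀ * (a₀ ∸ a₁) + a₀ * (b₀ ∸ b₁) ∎
  where
  open ≤-Reasoning
  shuffle : ∀ a b c d → a * (b + c) + d ≡ a * b + d + a * c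
  shuffle = solve-∀

module _ {n tail} (n′ : ℕ) (few : ∀ (ι : Vec Bool n) → (∑[ x ∈ bits n ] ⟦ skewed n′ ι x ⟧) ≤ tail) where

  -- The summands do not depend on coordinate i of z, so z may be taken to
  -- contain i; then g sees no constraint at i and f is hit by ∑-deficit.
  ∑-loss : ∀ f g → (∑[ i ∈ allFin n ] ∑[ z ∈ bits n ] loss f g i z) ≤
                   4 * (n′ * mass f g + n * (2 ^ n * 2 ^ n * tail))
  ∑-loss f g = begin
    ∑[ i ∈ allFin n ] ∑[ z ∈ bits n ] loss f g i z
      ≤⟨ ∑-mono (allFin n) fix ⟩
    ∑[ i ∈ allFin n ] 4 * (∑[ z ∈ bits n ] Q z * gap z i)   ≡⟨ *-distribˡ-∑ 4 (allFin n) _ ⟨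
    4 * (∑[ i ∈ allFin n ] ∑[ z ∈ bits n ] Q z * gap z i)   ≡⟨ cong (4 *_) (∑-comm (allFin n) (bits n) _) ⟩
    4 * (∑[ z ∈ bits n ] ∑[ i ∈ allFin n ] Q z * gap z i)
      ≤⟨ *-monoʳ-≤ 4 (∑-mono (bits n) bound) ⟩
    4 * (∑[ z ∈ bits n ] (n′ * (masked f z * Q z) + n * (2 ^ n * tail)))
      ≡⟨ cong (4 *_) (∑-distrib-+ (bits n) _ _) ⟩
    4 * ((∑[ z ∈ bits n ] n′ * (masked f z * Q z)) + (∑[ z ∈ bits n ] n * (2 ^ n * tail)))
      ≡⟨ cong (4 *_) (cong₂ _+_ (sym (*-distribˡ-∑ n′ (bits n) _))
           (trans (∑-const (bits n) _) (trans (cong (_* (n * (2 ^ n * tail))) (length-bits n)) (rearrange (2 ^ n) n tail)))) ⟩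
    4 * (n′ * mass f g + n * (2 ^ n * 2 ^ n * tail)) ∎
    where
    open ≤-Reasoning
    φ : Vec Bool n → Vec Bool n → ℕ
    φ z x = ⟦ f (x ∩ z) ⟧
    Q : Vec Bool n → ℕ
    Q z = masked g (∁ z)
    gap : Vec Bool n → Fin n → ℕ
    gap z i = count false (φ z) i ∸ count true (φ z) i
    rearrange : ∀ a n t → a * (n * (a * t)) ≡ n * (a * a * t)
    rearrange = solve-∀
    loss-inside : ∀ i z → lookup z i ≡ true → loss f g i z ≡ 2 * (Q z * gap z i)
    loss-inside i z eq = begin-equality
      loss f g i z
        ≡⟨ cong₂ _*_ (pinned-outside g (∁ z) i (trans (Vec.lookup-map i not z) (cong not eq)))
             (cong₂ _∸_ (pinned-inside f false z i eq) (pinned-inside f true z i eq)) ⟩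
      Q z * (2 * count false (φ z) i ∸ 2 * count true (φ z) i)
        ≡⟨ cong (Q z *_) (*-distribˡ-∸ 2 (count false (φ z) i) (count true (φ z) i)) ⟨
      Q z * (2 * gap z i)  ≡⟨ comm (Q z) (gap z i) ⟩
      2 * (Q z * gap z i)  ∎
      where
      comm : ∀ a b → a * (2 * b) ≡ 2 * (a * b)
      comm = solve-∀
    loss-update : ∀ i z → loss f g i (z [ i ]≔ true) ≡ loss f g i z
    loss-update i z = cong₂ _*_
      (trans (cong (λ y → pinned g false y i) (Vec.map-[]≔ not z i)) (pinned-update g false false (∁ z) i))
      (cong₂ _∸_ (pinned-update f false true z i) (pinned-update f true true z i))
    -- The 4 is one factor 2 for restricting z to the half containing i and another one from
    -- `pinned-inside`.
    fix : ∀ i → ∑ (bits n) (loss f g i) ≤ 4 * (∑[ z ∈ bits n ] Q z * gap z i)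
    fix i = begin
      ∑ (bits n) (loss f g i)   ≡⟨ ∑-cong (bits n) (loss-update i) ⟨
      ∑[ z ∈ bits n ] loss f g i (z [ i ]≔ true)  ≡⟨ ∑-bits-set i true (loss f g i) ⟩
      2 * (∑[ z ∈ bits n ] ⟦ does (lookup z i Bool.≟ true) ⟧ * loss f g i z)
        ≤⟨ *-monoʳ-≤ 2 (∑-mono (bits n) pointwise) ⟩
      2 * (∑[ z ∈ bits n ] 2 * (Q z * gap z i))   ≡⟨ cong (2 *_) (*-distribˡ-∑ 2 (bits n) _) ⟨
      2 * (2 * (∑[ z ∈ bits n ] Q z * gap z i))   ≡⟨ *-assoc 2 2 (∑[ z ∈ bits n ] Q z * gap z i) ⟨
      4 * (∑[ z ∈ bits n ] Q z * gap z i)  ∎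
      where
      pointwise : ∀ z → ⟦ does (lookup z i Bool.≟ true) ⟧ * loss f g i z ≤ 2 * (Q z * gap z i)
      pointwise z with lookup z i in eq
      ... | true  = ≤-reflexive (trans (*-identityˡ _) (loss-inside i z eq))
      ... | false = z≤n
    Q≤ : ∀ z → Q z ≤ 2 ^ n
    Q≤ z = ≤-trans (∑-≤-const (bits n) (λ y → ⟦⟧≤1 (g (y ∩ ∁ z))))
             (≤-reflexive (trans (*-identityʳ _) (length-bits n)))
    bound : ∀ z → (∑[ i ∈ allFin n ] Q z * gap z i) ≤ n′ * (masked f z * Q z) + n * (2 ^ n * tail)
    bound z = begin
      ∑[ i ∈ allFin n ] Q z * gap z i    ≡⟨ *-distribˡ-∑ (Q z) (allFin n) _ ⟨
      Q z * ∑ (allFin n) (gap z)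
        ≤⟨ *-monoʳ-≤ (Q z) (∑-deficit n′ few (φ z) λ x → ⟦⟧≤1 (f (x ∩ z))) ⟩
      Q z * (n′ * masked f z + n * tail)  ≡⟨ expand (Q z) n′ (masked f z) (n * tail) ⟩
      n′ * (masked f z * Q z) + Q z * (n * tail)
        ≤⟨ +-monoʳ-≤ (n′ * (masked f z * Q z)) (*-monoˡ-≤ (n * tail) (Q≤ z)) ⟩
      n′ * (masked f z * Q z) + 2 ^ n * (n * tail)
        ≡⟨ cong (n′ * (masked f z * Q z) +_) (comm (2 ^ n) n tail) ⟩
      n′ * (masked f z * Q z) + n * (2 ^ n * tail) ∎
      where
      expand : ∀ q a p t → q * (a * p + t) ≡ a * (p * q) + q * t
      expand = solve-∀
      comm : ∀ a n t → a * (n * t) ≡ n * (a * t)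
      comm = solve-∀

  -- The substitution of `∁ z` for z turns the second error term into the first with f and g
  -- exchanged. As `mass` is symmetric, the two bounds are equal and 4 becomes 8.
  corruption : ∀ f g → agreement f g false ≤
    agreement f g true + 8 * (n′ * mass f g + n * (2 ^ n * 2 ^ n * tail))
  corruption f g = begin
    agreement f g false
      ≤⟨ ∑-mono (allFin n) (λ i → ∑-mono (bits n) λ z →
           product-loss (pinned f false z i) (pinned f true z i) (pinned g false (∁ z) i) (pinned g true (∁ z) i)) ⟩
    ∑[ i ∈ allFin n ] ∑[ z ∈ bits n ] (agr i z + loss f g i z + loss′ i z)
      ≡⟨ ∑-cong (allFin n) (λ i → trans (∑-distrib-+ (bits n) _ _)
           (cong (_+ ∑ (bits n) (loss′ i)) (∑-distrib-+ (bits n) _ _))) ⟩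
    ∑[ i ∈ allFin n ] (∑ (bits n) (agr i) + ∑ (bits n) (loss f g i) + ∑ (bits n) (loss′ i))
      ≡⟨ trans (∑-distrib-+ (allFin n) _ _) (cong (_+ (∑[ i ∈ allFin n ] ∑ (bits n) (loss′ i))) (∑-distrib-+ (allFin n) _ _)) ⟩
    agreement f g true + (∑[ i ∈ allFin n ] ∑ (bits n) (loss f g i)) + (∑[ i ∈ allFin n ] ∑ (bits n) (loss′ i))
      ≡⟨ cong (agreement f g true + (∑[ i ∈ allFin n ] ∑ (bits n) (loss f g i)) +_) (∑-cong (allFin n) turn) ⟩
    agreement f g true + (∑[ i ∈ allFin n ] ∑ (bits n) (loss f g i)) + (∑[ i ∈ allFin n ] ∑ (bits n) (loss g f i))
      ≤⟨ +-mono-≤ (+-monoʳ-≤ (agreement f g true) (∑-loss f g)) (∑-loss g f) ⟩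
    agreement f g true + 4 * (n′ * mass f g + t) + 4 * (n′ * mass g f + t)
      ≡⟨ cong (λ o → agreement f g true + 4 * (n′ * mass f g + t) + 4 * (n′ * o + t)) (mass-sym g f) ⟩
    agreement f g true + 4 * (n′ * mass f g + t) + 4 * (n′ * mass f g + t)
      ≡⟨ double (agreement f g true) (n′ * mass f g + t) ⟩
    agreement f g true + 8 * (n′ * mass f g + t) ∎
    where
    open ≤-Reasoning
    t = n * (2 ^ n * 2 ^ n * tail)
    agr loss′ : Fin n → Vec Bool n → ℕ
    agr i z = pinned f true z i * pinned g true (∁ z) i
    loss′ i z = pinned f false z i * (pinned g false (∁ z) i ∸ pinned g true (∁ z) i)
    turn : ∀ i → ∑ (bits n) (loss′ i) ≡ ∑ (bits n) (loss g f i)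
    turn i = trans (∑-cong (bits n) λ z →
      cong (λ y → pinned f false y i * (pinned g false (∁ z) i ∸ pinned g true (∁ z) i)) (sym (∁-involutive z)))
      (∑-bits-not n (loss g f i))
    double : ∀ a b → a + 4 * b + 4 * b ≡ a + 8 * b
    double = solve-∀

-- From alternating computations to rectangles

-- Says that `as` lists every element exactly once, in the form of the sifting property of a
-- Kronecker delta.
Sifts : DecidableEquality A → List A → Set
Sifts {A} _≟_ as = ∀ a (h : A → ℕ) → (∑[ b ∈ as ] ⟦ does (a ≟ b) ⟧ * h b) ≡ h a

sifts-allFin : ∀ n → Sifts Fin._≟_ (allFin n)
sifts-allFin (suc n) zero h =
  trans (∑-allFin n _) (trans (cong₂ _+_ (*-identityˡ (h zero)) (∑-zero (allFin n))) (+-identityʳ (h zero)))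
sifts-allFin (suc n) (suc i) h =
  trans (∑-allFin n λ j → ⟦ does (suc i Fin.≟ j) ⟧ * h j) (sifts-allFin n i (h ∘ suc))

sifts-vecs : ∀ {_≟_ : DecidableEquality A} {as} → Sifts _≟_ as → ∀ n → Sifts (Vec.≡-dec _≟_) (vecs as n)
sifts-vecs sifts zero    []       h = trans (+-identityʳ _) (*-identityˡ (h []))
sifts-vecs {_≟_ = _≟_} {as} sifts (suc n) (a ∷ v) h = begin
  ∑[ u ∈ vecs as (suc n) ] ⟦ does (Vec.≡-dec _≟_ (a ∷ v) u) ⟧ * h u  ≡⟨ ∑-vecs as n _ ⟩
  ∑[ b ∈ as ] ∑[ u ∈ vecs as n ] ⟦ does (a ≟ b) ∧ does (Vec.≡-dec _≟_ v u) ⟧ * h (b ∷ u)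
    ≡⟨ ∑-cong as (λ b → trans
         (∑-cong (vecs as n) λ u → trans (cong (_* h (b ∷ u)) (⟦∧⟧ (does (a ≟ b)) _)) (*-assoc ⟦ does (a ≟ b) ⟧ _ _))
         (sym (*-distribˡ-∑ ⟦ does (a ≟ b) ⟧ (vecs as n) _))) ⟩
  ∑[ b ∈ as ] ⟦ does (a ≟ b) ⟧ * (∑[ u ∈ vecs as n ] ⟦ does (Vec.≡-dec _≟_ v u) ⟧ * h (b ∷ u))
    ≡⟨ sifts a _ ⟩
  ∑[ u ∈ vecs as n ] ⟦ does (Vec.≡-dec _≟_ v u) ⟧ * h (a ∷ u)  ≡⟨ sifts-vecs sifts n v (h ∘ (a ∷_)) ⟩
  h (a ∷ v) ∎
  where open ≡-Reasoning

Rectangle : Set → Set → Set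
Rectangle X Y = (X → Bool) × (Y → Bool)

-- When this number equals `⟦ F x y ⟧` for all x and y, the rectangles partition the inputs that F
-- accepts.
_covers_,_ : ∀ {X Y} → List (Rectangle X Y) → X → Y → ℕ
rs covers x , y = ∑[ r ∈ rs ] ⟦ proj₁ r x ⟧ * ⟦ proj₂ r y ⟧

-- Alternating computations on a shared memory: every history of the memory
-- contents is produced by a rectangle of inputs.
module Alternation {X Y M J : Set} (_≟_ : DecidableEquality M) (ms : List M) (sifts : Sifts _≟_ ms)
         (α : J → X → M → M) (β : J → Y → M → M) (out : M → Bool) where

  alternate : List J → M → X → Y → Bool
  alternate js μ x y = out (List.foldl (λ μ j → β j y (α j x μ)) μ js)

  -- Here u and v are guesses for the memory after Alice's and after Bob's part of round j. Bob's
  -- test starts from the guess u instead of Alice's actual result, so neither test looks at the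
  -- other's input.
  extend : J → M → M → M → Rectangle X Y → Rectangle X Y
  extend j μ u v (f , g) = (λ x → does (α j x μ ≟ u) ∧ f x) , (λ y → does (β j y u ≟ v) ∧ g y)

  rectangles : List J → M → List (Rectangle X Y)
  -- The output is a function of the final memory alone, so either side may record it.
  rectangles []       μ = ((λ _ → out μ) , (λ _ → true)) ∷ []
  rectangles (j ∷ js) μ =
    concatMap (λ u → concatMap (λ v → List.map (extend j μ u v) (rectangles js v)) ms) ms

  length-rectangles : ∀ js μ → length (rectangles js μ) ≡ (length ms * length ms) ^ length js
  length-rectangles []       μ = refl
  length-rectangles (j ∷ js) μ = trans
    (length-concatMap _ ms λ u → length-concatMap _ ms λ v →
      trans (List.length-map (extend j μ u v) (rectangles js v)) (length-rectangles js v))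
    (sym (*-assoc (length ms) (length ms) _))

  -- Exactly one history is consistent with the given inputs: sifting fixes u, then v, and the
  -- remaining rounds follow by induction.
  rectangles-cover : ∀ js μ x y → rectangles js μ covers x , y ≡ ⟦ alternate js μ x y ⟧
  rectangles-cover []       μ x y = trans (+-identityʳ _) (*-identityʳ _)
  rectangles-cover (j ∷ js) μ x y = begin
    rectangles (j ∷ js) μ covers x , y
      ≡⟨ trans (∑-concatMap _ ms _) (∑-cong ms λ u → trans (∑-concatMap _ ms _)
           (∑-cong ms λ v → ∑-map (extend j μ u v) (rectangles js v) _)) ⟩
    ∑[ u ∈ ms ] ∑[ v ∈ ms ] ∑[ r ∈ rectangles js v ]
      ⟦ does (α j x μ ≟ u) ∧ proj₁ r x ⟧ * ⟦ does (β j y u ≟ v) ∧ proj₂ r y ⟧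
      ≡⟨ ∑-cong ms (λ u → trans (∑-cong ms λ v → factor u v)
           (sym (*-distribˡ-∑ ⟦ does (α j x μ ≟ u) ⟧ ms _))) ⟩
    ∑[ u ∈ ms ] ⟦ does (α j x μ ≟ u) ⟧ * (∑[ v ∈ ms ] ⟦ does (β j y u ≟ v) ⟧ * rectangles js v covers x , y)
      ≡⟨ sifts (α j x μ) _ ⟩
    ∑[ v ∈ ms ] ⟦ does (β j y (α j x μ) ≟ v) ⟧ * rectangles js v covers x , y
      ≡⟨ sifts (β j y (α j x μ)) _ ⟩
    rectangles js (β j y (α j x μ)) covers x , y  ≡⟨ rectangles-cover js _ x y ⟩
    ⟦ alternate (j ∷ js) μ x y ⟧ ∎
    where
    open ≡-Reasoning
    factor : ∀ u v →
      (∑[ r ∈ rectangles js v ] ⟦ does (α j x μ ≟ u) ∧ proj₁ r x ⟧ * ⟦ does (β j y u ≟ v) ∧ proj₂ r y ⟧)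
      ≡ ⟦ does (α j x μ ≟ u) ⟧ * (⟦ does (β j y u ≟ v) ⟧ * rectangles js v covers x , y)
    factor u v = begin
      ∑[ r ∈ rectangles js v ] ⟦ does (α j x μ ≟ u) ∧ proj₁ r x ⟧ * ⟦ does (β j y u ≟ v) ∧ proj₂ r y ⟧
        ≡⟨ ∑-cong (rectangles js v) (λ r → trans
             (cong₂ _*_ (⟦∧⟧ (does (α j x μ ≟ u)) (proj₁ r x)) (⟦∧⟧ (does (β j y u ≟ v)) (proj₂ r y)))
             (shuffle ⟦ does (α j x μ ≟ u) ⟧ ⟦ proj₁ r x ⟧ ⟦ does (β j y u ≟ v) ⟧ ⟦ proj₂ r y ⟧)) ⟩
      ∑[ r ∈ rectangles js v ] ⟦ does (α j x μ ≟ u) ⟧ * ⟦ does (β j y u ≟ v) ⟧ * (⟦ proj₁ r x ⟧ * ⟦ proj₂ r y ⟧)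
        ≡⟨ *-distribˡ-∑ (⟦ does (α j x μ ≟ u) ⟧ * ⟦ does (β j y u ≟ v) ⟧) (rectangles js v) _ ⟨
      ⟦ does (α j x μ ≟ u) ⟧ * ⟦ does (β j y u ≟ v) ⟧ * rectangles js v covers x , y
        ≡⟨ *-assoc ⟦ does (α j x μ ≟ u) ⟧ ⟦ does (β j y u ≟ v) ⟧ _ ⟩
      ⟦ does (α j x μ ≟ u) ⟧ * (⟦ does (β j y u ≟ v) ⟧ * rectangles js v covers x , y) ∎
      where
      shuffle : ∀ a f b g → (a * f) * (b * g) ≡ a * b * (f * g)
      shuffle = solve-∀

-- The hard inputs: Alice's set lies in z and Bob's in its complement, except
-- that both sets contain i (b = true) or both miss it (b = false).
Question : ℕ → Set
Question n = Fin n × Vec Bool n × Vec Bool n × Vec Bool n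

alice bob : Bool → Question n → Vec Bool n
alice b (i , z , x , y) = (x ∩ z) [ i ]≔ b
bob   b (i , z , x , y) = (y ∩ ∁ z) [ i ]≔ b

questions : ∀ n → List (Question n)
questions n = concatMap (λ i → concatMap (λ z → concatMap (λ x → List.map (λ y → i , z , x , y)
  (bits n)) (bits n)) (bits n)) (allFin n)

∑-questions : ∀ n (f : Question n → ℕ) → ∑ (questions n) f ≡
  (∑[ i ∈ allFin n ] ∑[ z ∈ bits n ] ∑[ x ∈ bits n ] ∑[ y ∈ bits n ] f (i , z , x , y))
∑-questions n f = trans (∑-concatMap _ (allFin n) f) (∑-cong (allFin n) λ i →
  trans (∑-concatMap _ (bits n) f) (∑-cong (bits n) λ z →
  trans (∑-concatMap _ (bits n) f) (∑-cong (bits n) λ x → ∑-map _ (bits n) f)))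

-- The number of triples (z, x, y), that is, 8^n.
cube : ℕ → ℕ
cube n = 2 ^ n * (2 ^ n * 2 ^ n)

length-questions : ∀ n → length (questions n) ≡ n * cube n
length-questions n = trans
  (length-concatMap _ (allFin n) λ i → length-concatMap _ (bits n) λ z → length-concatMap _ (bits n) λ x →
    trans (List.length-map _ (bits n)) (length-bits n))
  (cong₂ _*_ (length-allFin n) (cong (λ l → l * (l * 2 ^ n)) (length-bits n)))

accepted : (Vec Bool n → Vec Bool n → Bool) → Bool → ℕ
accepted {n} F b = ∑[ q ∈ questions n ] ⟦ F (alice b q) (bob b q) ⟧

module _ (F : Vec Bool n → Vec Bool n → Bool) (rs : List (Rectangle (Vec Bool n) (Vec Bool n)))
         (cover : ∀ x y → rs covers x , y ≡ ⟦ F x y ⟧) where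

  ∑-cover : (a b : Vec Bool n → Vec Bool n) →
    (∑[ r ∈ rs ] (∑[ x ∈ bits n ] ⟦ proj₁ r (a x) ⟧) * (∑[ y ∈ bits n ] ⟦ proj₂ r (b y) ⟧)) ≡
    (∑[ x ∈ bits n ] ∑[ y ∈ bits n ] ⟦ F (a x) (b y) ⟧)
  ∑-cover a b = begin
    ∑[ r ∈ rs ] (∑[ x ∈ bits n ] ⟦ proj₁ r (a x) ⟧) * (∑[ y ∈ bits n ] ⟦ proj₂ r (b y) ⟧)
      ≡⟨ ∑-cong rs (λ r → ∑-* (bits n) (bits n) _ _) ⟩
    ∑[ r ∈ rs ] ∑[ x ∈ bits n ] ∑[ y ∈ bits n ] ⟦ proj₁ r (a x) ⟧ * ⟦ proj₂ r (b y) ⟧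
      ≡⟨ ∑-comm rs (bits n) _ ⟩
    ∑[ x ∈ bits n ] ∑[ r ∈ rs ] ∑[ y ∈ bits n ] ⟦ proj₁ r (a x) ⟧ * ⟦ proj₂ r (b y) ⟧
      ≡⟨ ∑-cong (bits n) (λ x → trans (∑-comm rs (bits n) _) (∑-cong (bits n) λ y → cover (a x) (b y))) ⟩
    ∑[ x ∈ bits n ] ∑[ y ∈ bits n ] ⟦ F (a x) (b y) ⟧ ∎
    where open ≡-Reasoning

  ∑-agreement : ∀ b → (∑[ r ∈ rs ] agreement (proj₁ r) (proj₂ r) b) ≡ accepted F b
  ∑-agreement b = trans (∑-comm rs (allFin n) _) (trans (∑-cong (allFin n) λ i →
    trans (∑-comm rs (bits n) _) (∑-cong (bits n) λ z → ∑-cover (λ x → (x ∩ z) [ i ]≔ b) (λ y → (y ∩ ∁ z) [ i ]≔ b)))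
    (sym (∑-questions n _)))

  module _ {tail} (n′ : ℕ) (few : ∀ (ι : Vec Bool n) → (∑[ x ∈ bits n ] ⟦ skewed n′ ι x ⟧) ≤ tail) where

    -- Each triple (z, x, y) lies in at most one rectangle, however many there are.
    ∑-mass : (∑[ r ∈ rs ] mass (proj₁ r) (proj₂ r)) ≤ cube n
    ∑-mass = begin
      ∑[ r ∈ rs ] mass (proj₁ r) (proj₂ r)
        ≡⟨ trans (∑-comm rs (bits n) _) (∑-cong (bits n) λ z → ∑-cover (_∩ z) (_∩ ∁ z)) ⟩
      ∑[ z ∈ bits n ] ∑[ x ∈ bits n ] ∑[ y ∈ bits n ] ⟦ F (x ∩ z) (y ∩ ∁ z) ⟧
        ≤⟨ ∑-≤-const (bits n) (λ z → ∑-≤-const (bits n) λ x → ∑-≤-const (bits n) λ y → ⟦⟧≤1 (F (x ∩ z) (y ∩ ∁ z))) ⟩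
      length (bits n) * (length (bits n) * (length (bits n) * 1))
        ≡⟨ trans (cong (λ l → length (bits n) * (length (bits n) * l)) (*-identityʳ _)) (cong (λ l → l * (l * l)) (length-bits n)) ⟩
      cube n ∎
      where open ≤-Reasoning

    accepted-corruption : accepted F false ≤
      accepted F true + 8 * (n′ * cube n + length rs * (n * (2 ^ n * 2 ^ n * tail)))
    accepted-corruption = begin
      accepted F false  ≡⟨ ∑-agreement false ⟨
      ∑[ r ∈ rs ] agreement (proj₁ r) (proj₂ r) false
        ≤⟨ ∑-mono rs (λ r → corruption n′ few (proj₁ r) (proj₂ r)) ⟩
      ∑[ r ∈ rs ] (agreement (proj₁ r) (proj₂ r) true + 8 * (n′ * mass (proj₁ r) (proj₂ r) + t))
        ≡⟨ trans (∑-distrib-+ rs _ _) (cong₂ _+_ (∑-agreement true) (trans (sym (*-distribˡ-∑ 8 rs _))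
             (cong (8 *_) (trans (∑-distrib-+ rs _ _) (cong₂ _+_ (sym (*-distribˡ-∑ n′ rs _)) (∑-const rs t)))))) ⟩
      accepted F true + 8 * (n′ * (∑[ r ∈ rs ] mass (proj₁ r) (proj₂ r)) + length rs * t)
        ≤⟨ +-monoʳ-≤ (accepted F true) (*-monoʳ-≤ 8 (+-monoˡ-≤ (length rs * t) (*-monoʳ-≤ n′ ∑-mass))) ⟩
      accepted F true + 8 * (n′ * cube n + length rs * t) ∎
      where
      open ≤-Reasoning
      t = n * (2 ^ n * 2 ^ n * tail)

-- The tail is 2^(k - q). As 49 ≤ 2^6, the slack of 6 between c and q lets 2^c rectangles pay the
-- factor k = 49 n′ with tails, for n′ · `cube k` in total.
few-rectangles-corruption : ∀ {q c} → c + 6 ≤ q → let k = 49 * (70 * q) in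
  (F : Vec Bool k → Vec Bool k → Bool) (rs : List (Rectangle (Vec Bool k) (Vec Bool k))) →
  (∀ x y → rs covers x , y ≡ ⟦ F x y ⟧) → length rs ≡ 2 ^ c →
  accepted F false ≤ accepted F true + 16 * (70 * q * cube k)
few-rectangles-corruption {q} {c} c+6≤q F rs cover len = begin
  accepted F false  ≤⟨ accepted-corruption F rs cover n′ few ⟩
  accepted F true + 8 * (n′ * cube k + length rs * (k * (2 ^ k * 2 ^ k * tail)))
    ≤⟨ +-monoʳ-≤ (accepted F true) (*-monoʳ-≤ 8 (+-monoʳ-≤ (n′ * cube k) tail-bound)) ⟩
  accepted F true + 8 * (n′ * cube k + n′ * cube k)
    ≡⟨ cong (accepted F true +_) (double (n′ * cube k)) ⟩
  accepted F true + 16 * (n′ * cube k) ∎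
  where
  open ≤-Reasoning
  n′ = 70 * q
  k = 49 * n′
  tail = 2 ^ (k ∸ q)
  q≤k : q ≤ k
  q≤k = ≤-trans (m≤n*m q 70) (m≤n*m n′ 49)
  tail*2^q : tail * 2 ^ q ≡ 2 ^ k
  tail*2^q = trans (sym (^-distribˡ-+-* 2 (k ∸ q) q)) (cong (2 ^_) (m∸n+n≡m q≤k))
  few : ∀ (ι : Vec Bool k) → (∑[ x ∈ bits k ] ⟦ skewed n′ ι x ⟧) ≤ tail
  few ι = *-cancelʳ-≤ _ tail (2 ^ q) {{m^n≢0 2 q}} (≤-trans (few-skewed q ι) (≤-reflexive (sym tail*2^q)))
  double : ∀ a → 8 * (a + a) ≡ 16 * a
  double = solve-∀
  tail-bound : length rs * (k * (2 ^ k * 2 ^ k * tail)) ≤ n′ * cube k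
  tail-bound = begin
    length rs * (k * (2 ^ k * 2 ^ k * tail))  ≡⟨ regroup (length rs) n′ (2 ^ k) tail ⟩
    n′ * (2 ^ k * (2 ^ k * (tail * (49 * length rs))))
      ≤⟨ *-monoʳ-≤ n′ (*-monoʳ-≤ (2 ^ k) (*-monoʳ-≤ (2 ^ k) tail*)) ⟩
    n′ * cube k ∎
    where
    regroup : ∀ l m a t → l * (49 * m * (a * a * t)) ≡ m * (a * (a * (t * (49 * l))))
    regroup = solve-∀
    tail* : tail * (49 * length rs) ≤ 2 ^ k
    tail* = begin
      tail * (49 * length rs)  ≡⟨ cong (λ l → tail * (49 * l)) len ⟩
      tail * (49 * 2 ^ c)      ≤⟨ *-monoʳ-≤ tail (*-monoˡ-≤ (2 ^ c) (m≤m+n 49 15)) ⟩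
      tail * (2 ^ 6 * 2 ^ c)   ≡⟨ cong (tail *_) (trans (*-comm (2 ^ 6) (2 ^ c)) (sym (^-distribˡ-+-* 2 c 6))) ⟩
      tail * 2 ^ (c + 6)       ≤⟨ *-monoʳ-≤ tail (^-monoʳ-≤ 2 c+6≤q) ⟩
      tail * 2 ^ q             ≡⟨ tail*2^q ⟩
      2 ^ k ∎

-- The misclassification rate

/-mono-≤ : ∀ a b {m n} .{{_ : NonZero m}} .{{_ : NonZero n}} → a * n ≤ b * m → ℤ.+ a / m ℚ.≤ ℤ.+ b / n
/-mono-≤ a b {m@(suc m-1)} {n@(suc n-1)} le = ℚ.toℚᵘ-cancel-≤ (begin
  ℚ.toℚᵘ (ℤ.+ a / m)  ≃⟨ ℚ.toℚᵘ-fromℚᵘ (mkℚᵘ (ℤ.+ a) m-1) ⟩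
  mkℚᵘ (ℤ.+ a) m-1    ≤⟨ *≤* (subst₂ ℤ._≤_ (ℤ.pos-* a n) (ℤ.pos-* b m) (ℤ.+≤+ le)) ⟩
  mkℚᵘ (ℤ.+ b) n-1    ≃⟨ ℚ.toℚᵘ-fromℚᵘ (mkℚᵘ (ℤ.+ b) n-1) ⟨
  ℚ.toℚᵘ (ℤ.+ b / n)  ∎)
  where open ℚᵘ.≤-Reasoning

/-cancel-≤ : ∀ a b {m n} .{{_ : NonZero m}} .{{_ : NonZero n}} → ℤ.+ a / m ℚ.≤ ℤ.+ b / n → a * n ≤ b * m
/-cancel-≤ a b {m@(suc m-1)} {n@(suc n-1)} le with step
  where
  open ℚᵘ.≤-Reasoning
  step : mkℚᵘ (ℤ.+ a) m-1 ℚᵘ.≤ mkℚᵘ (ℤ.+ b) n-1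
  step = begin
    mkℚᵘ (ℤ.+ a) m-1    ≃⟨ ℚ.toℚᵘ-fromℚᵘ (mkℚᵘ (ℤ.+ a) m-1) ⟨
    ℚ.toℚᵘ (ℤ.+ a / m)  ≤⟨ ℚ.toℚᵘ-mono-≤ le ⟩
    ℚ.toℚᵘ (ℤ.+ b / n)  ≃⟨ ℚ.toℚᵘ-fromℚᵘ (mkℚᵘ (ℤ.+ b) n-1) ⟩
    mkℚᵘ (ℤ.+ b) n-1    ∎
... | *≤* le′ = ℤ.drop‿+≤+ (subst₂ ℤ._≤_ (sym (ℤ.pos-* a n)) (sym (ℤ.pos-* b m)) le′)

module _ (f : A → ℚ) where

  ⨅ : List⁺ A → ℚ
  ⨅ as = List⁺.foldr₁ ℚ._⊓_ (List⁺.map f as)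

  ⨅-lower : ∀ as {a} → a List.∈ toList as → ⨅ as ℚ.≤ f a
  ⨅-lower (x ∷ [])     (here refl) = ℚ.≤-refl
  ⨅-lower (x ∷ y ∷ as) (here refl) = ℚ.p⊓q≤p (f x) _
  ⨅-lower (x ∷ y ∷ as) (there a∈)  = ℚ.≤-trans (ℚ.p⊓q≤q (f x) (⨅ (y ∷ as))) (⨅-lower (y ∷ as) a∈)

  ⨅-attained : ∀ as → ∃[ a ] ⨅ as ≡ f a
  ⨅-attained (x ∷ as) = go x as
    where
    go : ∀ x as → ∃[ a ] ⨅ (x ∷ as) ≡ f a
    go x []       = x , refl
    go x (y ∷ as) with ℚ.⊓-sel (f x) (⨅ (y ∷ as))
    ... | inj₁ eq = x , eq
    ... | inj₂ eq = let a , eq′ = go y as in a , trans eq eq′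

∈-partitions : ∀ (R : Subset n) → R List.∈ toList (partitions n)
∈-partitions []            = here refl
∈-partitions (inside  ∷ R) = List.∈-++⁺ˡ (List.∈-map⁺ (inside ∷_) (∈-partitions R))
∈-partitions {suc n} (outside ∷ R) =
  List.∈-++⁺ʳ (toList (List⁺.map (inside ∷_) (partitions n)))
    (List.∈-++⁺ˡ (List.∈-map⁺ (outside ∷_) (∈-partitions R)))

tally : Stream N m → Fin N → Sign → ℕ
tally []             x u = 0
tally ((x′ , u′) ∷ xs) x u = ⟦ does (x′ Fin.≟ x) ⟧ * ⟦ does (u′ Sign.≟ u) ⟧ + tally xs x u

does-∈? : ∀ (x : Fin n) R → does (x ∈? R) ≡ lookup R x
does-∈? zero    (inside  ∷ R) = refl
does-∈? zero    (outside ∷ R) = refl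
does-∈? (suc x) (_       ∷ R) = does-∈? x R

freq-tally : ∀ u R (xs : Stream N m) → freq u R xs ≡ (∑[ x ∈ allFin N ] ⟦ lookup R x ⟧ * tally xs x u)
freq-tally {N} u R [] = sym (trans (∑-cong (allFin N) λ x → *-zeroʳ ⟦ lookup R x ⟧) (∑-zero (allFin N)))
freq-tally {N} u R ((x′ , u′) ∷ xs) = begin
  freq u R ((x′ , u′) ∷ xs)
    ≡⟨ head-count (does (x′ ∈? R)) (does (u′ Sign.≟ u)) (freq u R xs) ⟩
  ⟦ does (x′ ∈? R) ⟧ * s + freq u R xs
    ≡⟨ cong₂ (λ b k → ⟦ b ⟧ * s + k) (does-∈? x′ R) (freq-tally u R xs) ⟩
  ⟦ lookup R x′ ⟧ * s + (∑[ x ∈ allFin N ] ⟦ lookup R x ⟧ * tally xs x u)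
    ≡⟨ cong (_+ (∑[ x ∈ allFin N ] ⟦ lookup R x ⟧ * tally xs x u)) (sifts-allFin N x′ λ x → ⟦ lookup R x ⟧ * s) ⟨
  (∑[ x ∈ allFin N ] ⟦ does (x′ Fin.≟ x) ⟧ * (⟦ lookup R x ⟧ * s)) + (∑[ x ∈ allFin N ] ⟦ lookup R x ⟧ * tally xs x u)
    ≡⟨ ∑-distrib-+ (allFin N) _ _ ⟨
  ∑[ x ∈ allFin N ] (⟦ does (x′ Fin.≟ x) ⟧ * (⟦ lookup R x ⟧ * s) + ⟦ lookup R x ⟧ * tally xs x u)
    ≡⟨ ∑-cong (allFin N) (λ x → factor ⟦ does (x′ Fin.≟ x) ⟧ ⟦ lookup R x ⟧ s (tally xs x u)) ⟩
  ∑[ x ∈ allFin N ] ⟦ lookup R x ⟧ * tally ((x′ , u′) ∷ xs) x u ∎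
  where
  open ≡-Reasoning
  s = ⟦ does (u′ Sign.≟ u) ⟧
  head-count : ∀ b c k → (if b ∧ c then suc else id) k ≡ ⟦ b ⟧ * ⟦ c ⟧ + k
  head-count true  true  k = refl
  head-count true  false k = refl
  head-count false c     k = refl
  factor : ∀ d r s t → d * (r * s) + r * t ≡ r * (d * s + t)
  factor = solve-∀

errors : Stream N m → Subset N → ℕ
errors xs A = (freq Sign.- A xs ⊓ freq Sign.+ A xs) + (freq Sign.- (∁ A) xs ⊓ freq Sign.+ (∁ A) xs)

conflicts : Stream N m → ℕ
conflicts {N} xs = ∑[ x ∈ allFin N ] (tally xs x Sign.- ⊓ tally xs x Sign.+)

∑-split : ∀ (A : Subset N) (f g : Fin N → ℕ) →
  (∑[ x ∈ allFin N ] ⟦ lookup A x ⟧ * f x) + (∑[ x ∈ allFin N ] ⟦ lookup (∁ A) x ⟧ * g x) ≡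
  (∑[ x ∈ allFin N ] (if lookup A x then f x else g x))
∑-split {N} A f g = trans (sym (∑-distrib-+ (allFin N) _ _)) (∑-cong (allFin N) λ x →
  trans (cong (λ b → ⟦ lookup A x ⟧ * f x + ⟦ b ⟧ * g x) (Vec.lookup-map x not A)) (choose (lookup A x) (f x) (g x)))
  where
  choose : ∀ b k l → ⟦ b ⟧ * k + ⟦ not b ⟧ * l ≡ (if b then k else l)
  choose true  k l = trans (+-identityʳ (1 * k)) (*-identityˡ k)
  choose false k l = *-identityˡ l

-- On either side of the partition, the sum of the minima is at most the minimum of the sums.
conflicts≤errors : ∀ (xs : Stream N m) A → conflicts xs ≤ errors xs A
conflicts≤errors {N} xs A = begin
  conflicts xs
    ≡⟨ ∑-cong (allFin N) (λ x → if-same (lookup A x) (low x)) ⟨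
  ∑[ x ∈ allFin N ] (if lookup A x then low x else low x)  ≡⟨ ∑-split A low low ⟨
  (∑[ x ∈ allFin N ] ⟦ lookup A x ⟧ * low x) + (∑[ x ∈ allFin N ] ⟦ lookup (∁ A) x ⟧ * low x)
    ≤⟨ +-mono-≤ (side A) (side (∁ A)) ⟩
  errors xs A ∎
  where
  open ≤-Reasoning
  low : Fin N → ℕ
  low x = tally xs x Sign.- ⊓ tally xs x Sign.+
  if-same : ∀ b (k : ℕ) → (if b then k else k) ≡ k
  if-same true  k = refl
  if-same false k = refl
  side : ∀ R → (∑[ x ∈ allFin N ] ⟦ lookup R x ⟧ * low x) ≤ freq Sign.- R xs ⊓ freq Sign.+ R xs
  side R = ⊓-glb
    (≤-trans (∑-mono (allFin N) λ x → *-monoʳ-≤ ⟦ lookup R x ⟧ (m⊓n≤m _ _)) (≤-reflexive (sym (freq-tally Sign.- R xs))))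
    (≤-trans (∑-mono (allFin N) λ x → *-monoʳ-≤ ⟦ lookup R x ⟧ (m⊓n≤n (tally xs x Sign.-) _)) (≤-reflexive (sym (freq-tally Sign.+ R xs))))

-- Ties, and with them the categories that never occur, go to the complement.
Majority : Stream N m → Subset N → Set
Majority xs A = ∀ x → lookup A x ≡ (tally xs x Sign.- <ᵇ tally xs x Sign.+)

-- Predicting + on A and - on the complement bounds the two minima, and its mistakes on each
-- category are exactly the minority there.
errors-majority : ∀ (xs : Stream N m) {A} → Majority xs A → errors xs A ≤ conflicts xs
errors-majority {N} xs {A} maj = begin
  errors xs A  ≤⟨ +-mono-≤ (m⊓n≤m _ _) (m⊓n≤n (freq Sign.- (∁ A) xs) _) ⟩
  freq Sign.- A xs + freq Sign.+ (∁ A) xs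
    ≡⟨ cong₂ _+_ (freq-tally Sign.- A xs) (freq-tally Sign.+ (∁ A) xs) ⟩
  (∑[ x ∈ allFin N ] ⟦ lookup A x ⟧ * tally xs x Sign.-) + (∑[ x ∈ allFin N ] ⟦ lookup (∁ A) x ⟧ * tally xs x Sign.+)
    ≡⟨ ∑-split A _ _ ⟩
  ∑[ x ∈ allFin N ] (if lookup A x then tally xs x Sign.- else tally xs x Sign.+)
    ≡⟨ ∑-cong (allFin N) (λ x → trans
         (cong (λ b → if b then tally xs x Sign.- else tally xs x Sign.+) (maj x)) (if-< (tally xs x Sign.-) _)) ⟩
  conflicts xs ∎
  where
  open ≤-Reasoning
  if-< : ∀ k l → (if k <ᵇ l then k else l) ≡ k ⊓ l
  if-< k l with k <ᵇ l in eq
  ... | true  = sym (m≤n⇒m⊓n≡m (<⇒≤ (<ᵇ⇒< k l (subst T (sym eq) _))))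
  ... | false = sym (m≥n⇒m⊓n≡n (≮⇒≥ λ lt → subst T eq (<⇒<ᵇ lt)))

majority : (xs : Stream N m) → Subset N
majority xs = Vec.tabulate λ x → tally xs x Sign.- <ᵇ tally xs x Sign.+

majority-Majority : (xs : Stream N m) → Majority xs (majority xs)
majority-Majority xs = Vec.lookup∘tabulate _

module _ {N m} .{{_ : NonZero m}} (xs : Stream N m) where

  L≤ : ∀ A k → errors xs A ≤ k → L xs A ℚ.≤ ℤ.+ k / m
  L≤ A k le = /-mono-≤ (errors xs A) k (*-monoˡ-≤ m le)

  L≥ : ∀ A k → k ≤ errors xs A → ℤ.+ k / m ℚ.≤ L xs A
  L≥ A k le = /-mono-≤ k (errors xs A) (*-monoˡ-≤ m le)

  OPT-lower : ∀ A → OPT xs ℚ.≤ L xs A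
  OPT-lower A = ⨅-lower (L xs) (partitions N) (∈-partitions A)

  OPT-attained : ∃[ A ] OPT xs ≡ L xs A
  OPT-attained = ⨅-attained (L xs) (partitions N)

  OPT-conflicts : OPT xs ≡ ℤ.+ conflicts xs / m
  OPT-conflicts = ℚ.≤-antisym
    (ℚ.≤-trans (OPT-lower (majority xs)) (L≤ (majority xs) (conflicts xs) (errors-majority xs (majority-Majority xs))))
    (ℚ.≤-trans (L≥ (proj₁ OPT-attained) (conflicts xs) (conflicts≤errors xs (proj₁ OPT-attained)))
      (ℚ.≤-reflexive (sym (proj₂ OPT-attained))))

  L-majority : ∀ {A} → Majority xs A → L xs A ℚ.≤ OPT xs
  L-majority {A} maj = ℚ.≤-trans (L≤ A (conflicts xs) (errors-majority xs maj)) (ℚ.≤-reflexive (sym OPT-conflicts))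

  OPT≡0 : conflicts xs ≡ 0 → OPT xs ≡ 0ℚ
  OPT≡0 eq = trans OPT-conflicts (trans (cong (λ k → ℤ.+ k / m) eq) (ℚ.0/n≡0 m))

  OPT≢0 : conflicts xs ≢ 0 → OPT xs ≢ 0ℚ
  OPT≢0 c≢0 eq = c≢0 (n≤0⇒n≡0 (≤-trans (≤-reflexive (sym (*-identityʳ _)))
    (/-cancel-≤ (conflicts xs) 0 {m} {1} (ℚ.≤-reflexive (trans (sym OPT-conflicts) (trans eq (sym (ℚ.0/n≡0 1))))))))

-- Set disjointness as a stream

tally-∉ : ∀ {xs : Stream N m} {x u} → All (_≢ (x , u)) xs → tally xs x u ≡ 0
tally-∉ {xs = []} [] = refl
tally-∉ {xs = (x′ , u′) ∷ xs} {x} {u} (≢xu ∷ rest) with x′ Fin.≟ x | u′ Sign.≟ u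
... | yes refl | yes refl = contradiction refl ≢xu
... | yes refl | no  _    = tally-∉ rest
... | no  _    | _        = tally-∉ rest

tally-∈ : ∀ {xs : Stream N m} {x u} → (x , u) ∈ xs → 1 ≤ tally xs x u
tally-∈ {x = x} {u} (here refl) with x Fin.≟ x | u Sign.≟ u
... | yes _  | yes _  = s≤s z≤n
... | yes _  | no u≢u = contradiction refl u≢u
... | no x≢x | _      = contradiction refl x≢x
tally-∈ (there p) = ≤-trans (tally-∈ p) (m≤n+m _ _)

term≤∑ : ∀ (f : Fin n → ℕ) i → f i ≤ ∑ (allFin n) f
term≤∑ {n} f i = ≤-trans (≤-reflexive (sym (sifts-allFin n i f)))
  (∑-mono (allFin n) λ j → ≤-trans (*-monoˡ-≤ (f j) (⟦⟧≤1 (does (i Fin.≟ j)))) (≤-reflexive (*-identityˡ (f j))))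

conflicts≡0 : ∀ (xs : Stream N m) → (∀ x → tally xs x Sign.- ≡ 0 ⊎ tally xs x Sign.+ ≡ 0) → conflicts xs ≡ 0
conflicts≡0 {N} xs clean = trans (∑-cong (allFin N) λ x → min≡0 (clean x)) (∑-zero (allFin N))
  where
  min≡0 : ∀ {a b} → a ≡ 0 ⊎ b ≡ 0 → a ⊓ b ≡ 0
  min≡0         (inj₁ refl) = refl
  min≡0 {a = a} (inj₂ refl) = ⊓-zeroʳ a

conflicts≢0 : ∀ {xs : Stream N m} {x} → (x , Sign.-) ∈ xs → (x , Sign.+) ∈ xs → conflicts xs ≢ 0
conflicts≢0 {x = x} p q eq = n≮0 (≤-trans (⊓-glb (tally-∈ p) (tally-∈ q))
  (≤-trans (term≤∑ _ x) (≤-reflexive eq)))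

-- Splits one pass into the part that depends on Alice's input only and the part that depends on
-- Bob's.
foldl-allFin-++ : ∀ {a b} (step : Fin (a + b) → A → B → B) (xs : Vec A a) (ys : Vec A b) μ →
  List.foldl (λ μ i → step i (lookup (xs Vec.++ ys) i) μ) μ (allFin (a + b)) ≡
  List.foldl (λ μ i → step (a ↑ʳ i) (lookup ys i) μ)
    (List.foldl (λ μ i → step (i ↑ˡ b) (lookup xs i) μ) μ (allFin a)) (allFin b)
foldl-allFin-++ step [] ys μ = refl
foldl-allFin-++ {a = suc a} {b} step (x ∷ xs) ys μ = begin
  List.foldl F (step zero x μ) (List.tabulate suc)
    ≡⟨ cong (List.foldl F _) (List.map-tabulate id suc) ⟨
  List.foldl F (step zero x μ) (List.map suc (allFin (a + b)))
    ≡⟨ List.foldl-map F suc _ (allFin (a + b)) ⟩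
  List.foldl (λ μ i → step (suc i) (lookup (xs Vec.++ ys) i) μ) (step zero x μ) (allFin (a + b))
    ≡⟨ foldl-allFin-++ (step ∘ suc) xs ys _ ⟩
  List.foldl H (List.foldl (λ μ i → step (suc (i ↑ˡ b)) (lookup xs i) μ) (step zero x μ) (allFin a)) (allFin b)
    ≡⟨ cong (λ μ → List.foldl H μ (allFin b)) (List.foldl-map G suc _ (allFin a)) ⟨
  List.foldl H (List.foldl G (step zero x μ) (List.map suc (allFin a))) (allFin b)
    ≡⟨ cong (λ is → List.foldl H (List.foldl G (step zero x μ) is) (allFin b)) (List.map-tabulate id suc) ⟩
  List.foldl H (List.foldl G (step zero x μ) (List.tabulate suc)) (allFin b) ∎
  where
  open ≡-Reasoning
  F = λ μ i → step i (lookup ((x ∷ xs) Vec.++ ys) i) μ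
  G = λ μ i → step (i ↑ˡ b) (lookup (x ∷ xs) i) μ
  H = λ μ i → step (suc a ↑ʳ i) (lookup ys i) μ

-- The e spare categories and r padding observations stretch an instance with n coordinates to
-- prescribed larger values of N and m.
module Encoding (n e r : ℕ) where

  element : Fin n → Fin (suc (n + e))
  element j = suc (j ↑ˡ e)

  -- The dummy element 0 only ever carries the label -, so it causes no conflict.
  mark : Sign → Vec Bool n → Fin n → Observation (suc (n + e))
  mark u x j = if lookup x j then (element j , u) else (zero , Sign.-)

  aliceStream : Vec Bool n → Stream (suc (n + e)) n
  aliceStream x = Vec.tabulate (mark Sign.- x)

  bobStream : Vec Bool n → Stream (suc (n + e)) (n + r)
  bobStream y = Vec.tabulate (mark Sign.+ y) Vec.++ Vec.replicate r (zero , Sign.-)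

  stream : Vec Bool n → Vec Bool n → Stream (suc (n + e)) (n + (n + r))
  stream x y = aliceStream x Vec.++ bobStream y

  mark-∈ : ∀ u x j → lookup x j ≡ true → mark u x j ≡ (element j , u)
  mark-∈ u x j eq = cong (λ b → if b then (element j , u) else (zero , Sign.-)) eq

  stream-− : ∀ x y i → lookup x i ≡ false → All (_≢ (element i , Sign.-)) (stream x y)
  stream-− x y i x∌i = All.++⁺ (All.tabulate⁺ alice≢) (All.++⁺ (All.tabulate⁺ bob≢) (pad r))
    where
    pad : ∀ r → All (_≢ (element i , Sign.-)) (Vec.replicate r (zero , Sign.-))
    pad zero    = []
    pad (suc r) = (λ ()) ∷ pad r
    alice≢ : ∀ j → mark Sign.- x j ≢ (element i , Sign.-)
    alice≢ j with lookup x j in eq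
    ... | false = λ ()
    ... | true  = λ eq′ → contradiction
      (trans (sym eq) (trans (cong (lookup x) (Fin.↑ˡ-injective e j i (Fin.suc-injective (cong proj₁ eq′)))) x∌i)) λ ()
    bob≢ : ∀ j → mark Sign.+ y j ≢ (element i , Sign.-)
    bob≢ j with lookup y j
    ... | false = λ ()
    ... | true  = λ ()

  -- Stated for every category v, since the dummy and the spare ones have to be conflict-free too.
  stream-+ : ∀ x y v → (∀ j → lookup y j ≡ true → element j ≢ v) → All (_≢ (v , Sign.+)) (stream x y)
  stream-+ x y v y∌v = All.++⁺ (All.tabulate⁺ alice≢) (All.++⁺ (All.tabulate⁺ bob≢) (pad r))
    where
    pad : ∀ r → All (_≢ (v , Sign.+)) (Vec.replicate r (zero , Sign.-))
    pad zero    = []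
    pad (suc r) = (λ ()) ∷ pad r
    alice≢ : ∀ j → mark Sign.- x j ≢ (v , Sign.+)
    alice≢ j with lookup x j
    ... | false = λ ()
    ... | true  = λ ()
    bob≢ : ∀ j → mark Sign.+ y j ≢ (v , Sign.+)
    bob≢ j with lookup y j in eq
    ... | false = λ ()
    ... | true  = λ eq′ → y∌v j eq (cong proj₁ eq′)

  conflicts-disjoint : ∀ x y → (∀ j → lookup x j ≡ true → lookup y j ≡ true → ⊥) → conflicts (stream x y) ≡ 0
  conflicts-disjoint x y disj = conflicts≡0 (stream x y) λ v → clean v (Fin.any? λ j → element j Fin.≟ v)
    where
    clean : ∀ v → Dec (∃[ j ] element j ≡ v) → tally (stream x y) v Sign.- ≡ 0 ⊎ tally (stream x y) v Sign.+ ≡ 0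
    clean v (no  ∄)          = inj₂ (tally-∉ (stream-+ x y v λ j _ eq → ∄ (j , eq)))
    clean v (yes (i , refl)) with lookup x i in eq
    ... | false = inj₁ (tally-∉ (stream-− x y i eq))
    ... | true  = inj₂ (tally-∉ (stream-+ x y v λ j y∋j eq′ →
      disj i eq (subst (λ j → lookup y j ≡ true) (Fin.↑ˡ-injective e j i (Fin.suc-injective eq′)) y∋j)))

  conflicts-intersecting : ∀ x y i → lookup x i ≡ true → lookup y i ≡ true → conflicts (stream x y) ≢ 0
  conflicts-intersecting x y i x∋i y∋i = conflicts≢0 {x = element i}
    (Vec.∈-++⁺ˡ (subst (_∈ aliceStream x) (mark-∈ Sign.- x i x∋i) (Vec.∈-tabulate⁺ (mark Sign.- x) i)))
    (Vec.∈-++⁺ʳ (aliceStream x) (Vec.∈-++⁺ˡ (subst (_∈ Vec.tabulate (mark Sign.+ y)) (mark-∈ Sign.+ y i y∋i)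
      (Vec.∈-tabulate⁺ (mark Sign.+ y) i))))

  module _ {passes w s} (alg : Deterministic (Observation (suc (n + e))) Bool (n + (n + r)) passes w s) where
    open Deterministic alg hiding (run)

    memories : List (Memory w s)
    memories = vecs (allFin (2 ^ w)) s

    sifts-memories : Sifts (Vec.≡-dec Fin._≟_) memories
    sifts-memories = sifts-vecs (sifts-allFin (2 ^ w)) s

    alicePass bobPass : Fin passes → Vec Bool n → Memory w s → Memory w s
    alicePass j x μ = List.foldl (λ μ i → step j (i ↑ˡ (n + r)) (lookup (aliceStream x) i) μ) μ (allFin n)
    bobPass   j y μ = List.foldl (λ μ i → step j (n ↑ʳ i) (lookup (bobStream y) i) μ) μ (allFin (n + r))

    open Alternation (Vec.≡-dec Fin._≟_) memories sifts-memories alicePass bobPass output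

    run-alternate : ∀ x y → run alg (stream x y) ≡ alternate (allFin passes) init x y
    run-alternate x y = cong output (List.foldl-cong
      (λ μ j → foldl-allFin-++ (step j) (aliceStream x) (bobStream y) μ) init (allFin passes))

    runRectangles : List (Rectangle (Vec Bool n) (Vec Bool n))
    runRectangles = rectangles (allFin passes) init

    runRectangles-cover : ∀ x y → runRectangles covers x , y ≡ ⟦ run alg (stream x y) ⟧
    runRectangles-cover x y = trans
      (rectangles-cover (allFin passes) init x y)
      (cong ⟦_⟧ (sym (run-alternate x y)))

    length-runRectangles : length runRectangles ≡ 2 ^ (2 * passes * (s * w))
    length-runRectangles = begin
      length runRectangles
        ≡⟨ length-rectangles (allFin passes) init ⟩
      (length memories * length memories) ^ length (allFin passes)
        ≡⟨ cong₂ (λ a b → (a * a) ^ b) length-memories (length-allFin passes) ⟩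
      (2 ^ (s * w) * 2 ^ (s * w)) ^ passes
        ≡⟨ cong (_^ passes) (^-distribˡ-+-* 2 (s * w) (s * w)) ⟨
      (2 ^ (s * w + s * w)) ^ passes  ≡⟨ ^-*-assoc 2 (s * w + s * w) passes ⟩
      2 ^ ((s * w + s * w) * passes)  ≡⟨ cong (2 ^_) (shuffle (s * w) passes) ⟩
      2 ^ (2 * passes * (s * w)) ∎
      where
      open ≡-Reasoning
      length-memories : length memories ≡ 2 ^ (s * w)
      length-memories = trans (length-vecs (allFin (2 ^ w)) s)
        (trans (cong (_^ s) (length-allFin (2 ^ w))) (trans (^-*-assoc 2 w s) (cong (2 ^_) (*-comm w s))))
      shuffle : ∀ a p → (a + a) * p ≡ 2 * p * a
      shuffle = solve-∀

-- Acceptance counts of a correct algorithm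

length-filter-∑ : ∀ {P : Pred A 0ℓ} (P? : Decidable P) xs → length (List.filter P? xs) ≡ (∑[ x ∈ xs ] ⟦ does (P? x) ⟧)
length-filter-∑ P? []       = refl
length-filter-∑ P? (x ∷ xs) with does (P? x)
... | true  = cong suc (length-filter-∑ P? xs)
... | false = length-filter-∑ P? xs

Pr≥2/3 : ∀ {P : Pred A 0ℓ} (as : List⁺ A) (P? : Decidable P) → ℤ.+ 2 / 3 ℚ.≤ Pr as P? →
         2 * List⁺.length as ≤ (∑[ a ∈ toList as ] ⟦ does (P? a) ⟧) * 3
Pr≥2/3 as P? le = subst (λ k → 2 * List⁺.length as ≤ k * 3) (length-filter-∑ P? (toList as))
  (/-cancel-≤ 2 (length (List.filter P? (toList as))) le)

module _ {N m passes w s} .{{_ : NonZero m}} (𝒜 : Randomized (Observation N) Bool m passes w s) where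

  accepts : Stream N m → ℕ
  accepts xs = ∑[ alg ∈ toList 𝒜 ] ⟦ run alg xs ⟧

  correct? : (xs : Stream N m) → Decidable λ (alg : Deterministic (Observation N) Bool m passes w s) → run alg xs ≡ ⌊ OPT xs ℚ.≟ 0ℚ ⌋
  correct? xs alg = run alg xs Bool.≟ ⌊ OPT xs ℚ.≟ 0ℚ ⌋

  module _ (decides : DecidesOPT≡0 𝒜) where

    accepts-conflictFree : ∀ xs → conflicts xs ≡ 0 → 2 * List⁺.length 𝒜 ≤ accepts xs * 3
    accepts-conflictFree xs eq = subst (λ k → 2 * List⁺.length 𝒜 ≤ k * 3)
      (∑-cong (toList 𝒜) λ alg → trans (cong (λ b → ⟦ does (run alg xs Bool.≟ b) ⟧) answer) (≟-true (run alg xs)))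
      (Pr≥2/3 𝒜 (correct? xs) (decides xs))
      where
      answer : ⌊ OPT xs ℚ.≟ 0ℚ ⌋ ≡ true
      answer = trans (isYes≗does (OPT xs ℚ.≟ 0ℚ)) (dec-true (OPT xs ℚ.≟ 0ℚ) (OPT≡0 xs eq))
      ≟-true : ∀ b → ⟦ does (b Bool.≟ true) ⟧ ≡ ⟦ b ⟧
      ≟-true true  = refl
      ≟-true false = refl

    accepts-conflict : ∀ xs → conflicts xs ≢ 0 → accepts xs * 3 ≤ List⁺.length 𝒜
    accepts-conflict xs c≢0 = +-cancelʳ-≤ (2 * K) _ _ (begin
      accepts xs * 3 + 2 * K             ≤⟨ +-monoʳ-≤ (accepts xs * 3) rejections ⟩
      accepts xs * 3 + rejects * 3       ≡⟨ *-distribʳ-+ 3 (accepts xs) rejects ⟨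
      (accepts xs + rejects) * 3         ≡⟨ cong (_* 3) total ⟩
      K * 3                              ≡⟨ *-comm K 3 ⟩
      K + 2 * K ∎)
      where
      open ≤-Reasoning
      K = List⁺.length 𝒜
      rejects = ∑[ alg ∈ toList 𝒜 ] ⟦ not (run alg xs) ⟧
      answer : ⌊ OPT xs ℚ.≟ 0ℚ ⌋ ≡ false
      answer = trans (isYes≗does (OPT xs ℚ.≟ 0ℚ)) (dec-false (OPT xs ℚ.≟ 0ℚ) (OPT≢0 xs c≢0))
      ≟-false : ∀ b → ⟦ does (b Bool.≟ false) ⟧ ≡ ⟦ not b ⟧
      ≟-false true  = refl
      ≟-false false = refl
      rejections : 2 * K ≤ rejects * 3
      rejections = subst (λ k → 2 * K ≤ k * 3)
        (∑-cong (toList 𝒜) λ alg → trans (cong (λ b → ⟦ does (run alg xs Bool.≟ b) ⟧) answer) (≟-false (run alg xs)))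
        (Pr≥2/3 𝒜 (correct? xs) (decides xs))
      one : ∀ b → ⟦ b ⟧ + ⟦ not b ⟧ ≡ 1
      one true  = refl
      one false = refl
      total : accepts xs + rejects ≡ K
      total = trans (sym (∑-distrib-+ (toList 𝒜) (λ alg → ⟦ run alg xs ⟧) _)) (trans (∑-cong (toList 𝒜) λ alg → one (run alg xs))
        (trans (∑-const (toList 𝒜) 1) (*-identityʳ K)))

alice∌ : ∀ (q : Question n) → lookup (alice false q) (proj₁ q) ≡ false
alice∌ (i , z , x , y) = Vec.lookup∘updateAt i (x ∩ z)

alice∋ : ∀ (q : Question n) → lookup (alice true q) (proj₁ q) ≡ true
alice∋ (i , z , x , y) = Vec.lookup∘updateAt i (x ∩ z)

bob∋ : ∀ (q : Question n) → lookup (bob true q) (proj₁ q) ≡ true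
bob∋ (i , z , x , y) = Vec.lookup∘updateAt i (y ∩ ∁ z)

disjoint : ∀ (q : Question n) j → lookup (alice false q) j ≡ true → lookup (bob false q) j ≡ true → ⊥
disjoint q@(i , z , x , y) j a b with j Fin.≟ i
... | yes refl = contradiction (trans (sym a) (alice∌ q)) λ ()
... | no j≢i   = clash (lookup x j) (lookup y j) (lookup z j)
  (trans (sym (trans (Vec.lookup∘updateAt′ j i j≢i (x ∩ z)) (Vec.lookup-zipWith _∧_ j x z))) a)
  (trans (sym (trans (Vec.lookup∘updateAt′ j i j≢i (y ∩ ∁ z)) (trans (Vec.lookup-zipWith _∧_ j y (∁ z))
    (cong (lookup y j ∧_) (Vec.lookup-map j not z))))) b)
  where
  clash : ∀ b c d → b ∧ d ≡ true → c ∧ not d ≡ true → ⊥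
  clash true  true  true  _  ()
  clash true  false true  _  ()
  clash true  _     false () _
  clash false _     _     () _

-- Averages over the random choices and the questions. In units of X, three times the acceptances
-- are at least 2 · 49 = 98 on disjoint inputs and at most 49 on intersecting ones, while corruption
-- allows a difference of only 3 · 16 = 48.
no-small-space : ∀ {passes w s e r k n′} .{{_ : NonZero (k + (k + r))}} .{{_ : NonZero n′}} → k ≡ 49 * n′ →
  (∀ (F : Vec Bool k → Vec Bool k → Bool) rs → (∀ x y → rs covers x , y ≡ ⟦ F x y ⟧) →
    length rs ≡ 2 ^ (2 * passes * (s * w)) → accepted F false ≤ accepted F true + 16 * (n′ * cube k)) →
  (𝒜 : Randomized (Observation (suc (k + e))) Bool (k + (k + r)) passes w s) → DecidesOPT≡0 𝒜 → ⊥
no-small-space {passes} {w} {s} {e} {r} {k} {n′} {{_}} {{n′≢0}} k≡ corrupt 𝒜 decides = <-irrefl refl (begin-strict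
  97 * X                        <⟨ *-monoˡ-< X {{X≢0}} (n<1+n 97) ⟩
  98 * X                        ≡⟨ trans (two K n′ (cube k)) (cong (λ l → l * cube k * (2 * K)) (sym k≡)) ⟩
  k * cube k * (2 * K)          ≡⟨ cong (_* (2 * K)) (length-questions k) ⟨
  length (questions k) * (2 * K) ≡⟨ ∑-const (questions k) (2 * K) ⟨
  ∑[ ω ∈ questions k ] 2 * K
    ≤⟨ ∑-mono (questions k) (λ ω → accepts-conflictFree 𝒜 decides (stream (alice false ω) (bob false ω))
         (conflicts-disjoint (alice false ω) (bob false ω) (disjoint ω))) ⟩
  ∑[ ω ∈ questions k ] accepts 𝒜 (stream (alice false ω) (bob false ω)) * 3
    ≡⟨ trans (cong (_* 3) (swap false)) (*-distribʳ-∑ 3 (questions k) _) ⟨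
  (∑[ alg ∈ toList 𝒜 ] accepted (F alg) false) * 3
    ≤⟨ *-monoˡ-≤ 3 (∑-mono (toList 𝒜) λ alg → corrupt (F alg)
         (runRectangles alg) (runRectangles-cover alg) (length-runRectangles alg)) ⟩
  (∑[ alg ∈ toList 𝒜 ] (accepted (F alg) true + 16 * (n′ * cube k))) * 3
    ≡⟨ cong (_* 3) (trans (∑-distrib-+ (toList 𝒜) (λ alg → accepted (F alg) true) _)
         (cong ((∑[ alg ∈ toList 𝒜 ] accepted (F alg) true) +_) (∑-const (toList 𝒜) _))) ⟩
  ((∑[ alg ∈ toList 𝒜 ] accepted (F alg) true) + K * (16 * (n′ * cube k))) * 3
    ≡⟨ *-distribʳ-+ 3 (∑[ alg ∈ toList 𝒜 ] accepted (F alg) true) _ ⟩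
  (∑[ alg ∈ toList 𝒜 ] accepted (F alg) true) * 3 + K * (16 * (n′ * cube k)) * 3
    ≤⟨ +-mono-≤ rejected (≤-reflexive (three K (n′ * cube k))) ⟩
  49 * X + 48 * X               ≡⟨ *-distribʳ-+ X 49 48 ⟨
  97 * X ∎)
  where
  open ≤-Reasoning
  open Encoding k e r
  K = List⁺.length 𝒜
  X = K * (n′ * cube k)
  F : Deterministic (Observation (suc (k + e))) Bool (k + (k + r)) passes w s → Vec Bool k → Vec Bool k → Bool
  F alg x y = run alg (stream x y)
  X≢0 : NonZero X
  X≢0 = m*n≢0 K _ {{_}} {{m*n≢0 n′ (cube k)
    {{n′≢0}} {{m*n≢0 (2 ^ k) (2 ^ k * 2 ^ k) {{m^n≢0 2 k}} {{m*n≢0 (2 ^ k) (2 ^ k) {{m^n≢0 2 k}} {{m^n≢0 2 k}}}}}}}}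
  two : ∀ a b c → 98 * (a * (b * c)) ≡ 49 * b * c * (2 * a)
  two = solve-∀
  three : ∀ a b → a * (16 * b) * 3 ≡ 48 * (a * b)
  three = solve-∀
  swap : ∀ b → (∑[ alg ∈ toList 𝒜 ] accepted (F alg) b) ≡
               (∑[ ω ∈ questions k ] accepts 𝒜 (stream (alice b ω) (bob b ω)))
  swap b = ∑-comm (toList 𝒜) (questions k) _
  rejected : (∑[ alg ∈ toList 𝒜 ] accepted (F alg) true) * 3 ≤ 49 * X
  rejected = begin
    (∑[ alg ∈ toList 𝒜 ] accepted (F alg) true) * 3
      ≡⟨ trans (cong (_* 3) (swap true)) (*-distribʳ-∑ 3 (questions k) _) ⟩
    ∑[ ω ∈ questions k ] accepts 𝒜 (stream (alice true ω) (bob true ω)) * 3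
      ≤⟨ ∑-≤-const (questions k) (λ ω → accepts-conflict 𝒜 decides (stream (alice true ω) (bob true ω))
           (conflicts-intersecting (alice true ω) (bob true ω) (proj₁ ω) (alice∋ ω) (bob∋ ω))) ⟩
    length (questions k) * K   ≡⟨ cong (_* K) (length-questions k) ⟩
    k * cube k * K             ≡⟨ trans (cong (λ l → l * cube k * K) k≡) (one n′ (cube k) K) ⟩
    49 * X ∎
    where
    one : ∀ b c a → 49 * b * c * a ≡ 49 * (a * (b * c))
    one = solve-∀

-- Simulation of the word RAM

Store : Set
Store = ℕ → ℕ

infixl 6 _[_↦_]
_[_↦_] : Store → ℕ → ℕ → Store
(M [ d ↦ v ]) a = if a ≡ᵇ d then v else M a

↦-same : ∀ (M : Store) d v → (M [ d ↦ v ]) d ≡ v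
↦-same M d v with d ≡ᵇ d in eq
... | true  = refl
... | false = contradiction (≡⇒≡ᵇ d d refl) (subst T eq)

↦-other : ∀ (M : Store) {a d} v → a ≢ d → (M [ d ↦ v ]) a ≡ M a
↦-other M {a} {d} v a≢d with a ≡ᵇ d in eq
... | true  = contradiction (≡ᵇ⇒≡ a d (subst T (sym eq) _)) a≢d
... | false = refl

-- The word RAM with eight scratch cells, simulated on stores of unbounded
-- numbers as long as nothing overflows.
module Simulation (w k : ℕ) where

  open RAM w

  size : ℕ
  size = 8 + k

  infix 4 _≋_
  _≋_ : Memory w size → Store → Set
  μ ≋ M = ∀ a → a < size → read μ a ≡ M a

  toℕ-word : ∀ {v} → v < 2 ^ w → toℕ (word v) ≡ v
  toℕ-word {v} v< = trans (Fin.toℕ-fromℕ< (m%n<n v (2 ^ w) {{m^n≢0 2 w}}))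
    (m<n⇒m%n≡m {{m^n≢0 2 w}} v<)

  read-write : ∀ {s} (μ : Memory w s) d v a → a < s → v < 2 ^ w →
               read (write μ d v) a ≡ (if a ≡ᵇ d then v else read μ a)
  read-write (_ ∷ μ) zero    v zero    _       v< = toℕ-word v<
  read-write (_ ∷ μ) zero    v (suc a) _       v< = refl
  read-write (_ ∷ μ) (suc d) v zero    _       v< = refl
  read-write (_ ∷ μ) (suc d) v (suc a) (s≤s a<) v< = read-write μ d v a a< v<

  read<2^w : ∀ {s} (μ : Memory w s) a → read μ a < 2 ^ w
  read<2^w []      a       = m^n>0 2 w
  read<2^w (v ∷ μ) zero    = Fin.toℕ<n v
  read<2^w (_ ∷ μ) (suc a) = read<2^w μ a

  read-start : ∀ {s N} → N < 2 ^ w → 0 < s → read (start s N) 0 ≡ N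
  read-start {suc s} N< _ = toℕ-word N<

  read-replicate : ∀ s a → read (Vec.replicate s (word 0)) a ≡ 0
  read-replicate zero    a       = refl
  read-replicate (suc s) zero    = toℕ-word (m^n>0 2 w)
  read-replicate (suc s) (suc a) = read-replicate s a

  read-start-suc : ∀ s N a → read (start s N) (suc a) ≡ 0
  read-start-suc zero    N a = refl
  read-start-suc (suc s) N a = read-replicate s a

  write-≋ : ∀ μ {M} d {v} → μ ≋ M → v < 2 ^ w → write μ d v ≋ M [ d ↦ v ]
  write-≋ μ {M} d {v} μ≋M v< a a< = trans (read-write μ d v a a< v<) (cong (if a ≡ᵇ d then v else_) (μ≋M a a<))

  -- Values already in memory are words. So moving or decreasing them needs no overflow condition in
  -- a `Trace`.
  stored<2^w : ∀ μ {M} → μ ≋ M → ∀ a → a < size → M a < 2 ^ w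
  stored<2^w μ μ≋M a a< = subst (_< 2 ^ w) (μ≋M a a<) (read<2^w μ a)

  scratch : ∀ {a} → T (a <ᵇ 8) → a < size
  scratch {a} a<8 = <-≤-trans (<ᵇ⇒< a 8 a<8) (m≤m+n 8 k)

  -- A coin-free run from position n with t steps to spare; the side conditions keep the arithmetic
  -- within a word. `store` accepts any address, as writes beyond the memory are invisible to `_≋_`.
  data Trace (code : Code) : ℕ → ℕ → Store → Store → Set where
    halt   : ∀ {t n M} → fetch code n ≡ nothing → Trace code t n M M
    set    : ∀ {t n M M′ d v} → fetch code n ≡ just (set d v) → v < 2 ^ w →
             Trace code t (suc n) (M [ d ↦ v ]) M′ → Trace code (suc t) n M M′
    add    : ∀ {t n M M′ d a b} {_ : T (a <ᵇ 8)} {_ : T (b <ᵇ 8)} → fetch code n ≡ just (add d a b) →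
             M a + M b < 2 ^ w → Trace code t (suc n) (M [ d ↦ M a + M b ]) M′ → Trace code (suc t) n M M′
    sub    : ∀ {t n M M′ d a b} {_ : T (a <ᵇ 8)} {_ : T (b <ᵇ 8)} → fetch code n ≡ just (sub d a b) →
             M b ≤ M a → Trace code t (suc n) (M [ d ↦ M a ∸ M b ]) M′ → Trace code (suc t) n M M′
    load   : ∀ {t n M M′ d p} {_ : T (p <ᵇ 8)} → fetch code n ≡ just (load d p) → M p < size →
             Trace code t (suc n) (M [ d ↦ M (M p) ]) M′ → Trace code (suc t) n M M′
    store  : ∀ {t n M M′ p a} {_ : T (p <ᵇ 8)} {_ : T (a <ᵇ 8)} → fetch code n ≡ just (store p a) →
             Trace code t (suc n) (M [ M p ↦ M a ]) M′ → Trace code (suc t) n M M′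
    jump   : ∀ {t n M M′ l} → fetch code n ≡ just (jump l) →
             Trace code t l M M′ → Trace code (suc t) n M M′
    taken  : ∀ {t n M M′ a b l} {_ : T (a <ᵇ 8)} {_ : T (b <ᵇ 8)} → fetch code n ≡ just (jlt a b l) →
             M a < M b → Trace code t l M M′ → Trace code (suc t) n M M′
    missed : ∀ {t n M M′ a b l} {_ : T (a <ᵇ 8)} {_ : T (b <ᵇ 8)} → fetch code n ≡ just (jlt a b l) →
             M b ≤ M a → Trace code t (suc n) M M′ → Trace code (suc t) n M M′

  steps-step : ∀ {s t} code b (bs : Vec Bool t) (c : Config s) {instr} → fetch code (pc c) ≡ just instr →
               steps code (b ∷ bs) c ≡ steps code bs (execute b instr c)
  steps-step code b bs c eq with fetch code (pc c) | eq
  ... | just _ | refl = refl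

  steps-halted : ∀ {s t} code (bs : Vec Bool t) (c : Config s) → fetch code (pc c) ≡ nothing → steps code bs c ≡ c
  steps-halted code []       c eq = refl
  steps-halted code (b ∷ bs) c eq with fetch code (pc c) | eq
  ... | nothing | refl = refl

  Reaches : Code → Config size → Store → Set
  Reaches code c M = fetch code (pc c) ≡ nothing × mem c ≋ M

  trace-steps : ∀ {code t t′ n μ M M′} → Trace code t n M M′ → t ≤ t′ → μ ≋ M → (bs : Vec Bool t′) →
                Reaches code (steps code bs (config n μ)) M′
  trace-steps {code} {n = n} {μ} {M} (halt eq) _ μ≋M bs = subst (λ c → Reaches code c M)
    (sym (steps-halted code bs (config n μ) eq)) (eq , μ≋M)
  trace-steps {code} {n = n} {μ} {M′ = M′} (set {d = d} {v} eq v< tr) (s≤s t≤) μ≋M (b ∷ bs) =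
    subst (λ c → Reaches code c M′) (sym (steps-step code b bs (config n μ) eq))
      (trace-steps tr t≤ (write-≋ μ d μ≋M v<) bs)
  trace-steps {code} {n = n} {μ} {M} {M′} (add {d = d} {x} {y} {x<} {y<} eq v< tr) (s≤s t≤) μ≋M (b ∷ bs) =
    subst (λ c → Reaches code c M′) (sym (steps-step code b bs (config n μ) eq))
      (trace-steps tr t≤ (subst (λ v → write μ d v ≋ M [ d ↦ M x + M y ])
        (sym (cong₂ _+_ (μ≋M x (scratch x<)) (μ≋M y (scratch y<)))) (write-≋ μ d μ≋M v<)) bs)
  trace-steps {code} {n = n} {μ} {M} {M′} (sub {d = d} {x} {y} {x<} {y<} eq le tr) (s≤s t≤) μ≋M (b ∷ bs) =
    subst (λ c → Reaches code c M′) (sym (steps-step code b bs (config n μ) eq))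
      (trace-steps tr t≤ wrapped bs)
    where
    open ≡-Reasoning
    Mx< : M x < 2 ^ w
    Mx< = stored<2^w μ μ≋M x (scratch x<)
    -- The machine adds 2^w - b, which is subtraction modulo 2^w; for b ≤ a the reduction removes
    -- exactly the extra 2^w.
    wrap : ∀ {a b c} → b ≤ a → a < c → a + (c ∸ b) ≡ (a ∸ b) + c
    wrap {a} {b} {c} b≤a a<c = begin
      a + (c ∸ b)             ≡⟨ +-∸-assoc a (<⇒≤ (≤-<-trans b≤a a<c)) ⟨
      (a + c) ∸ b             ≡⟨ cong (_∸ b) (+-comm a c) ⟩
      (c + a) ∸ b             ≡⟨ +-∸-assoc c b≤a ⟩
      c + (a ∸ b)             ≡⟨ +-comm c (a ∸ b) ⟩
      (a ∸ b) + c             ∎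
    word-wrap : word (read μ x + (2 ^ w ∸ read μ y)) ≡ word (M x ∸ M y)
    word-wrap = Fin.toℕ-injective (begin
      toℕ (word (read μ x + (2 ^ w ∸ read μ y)))
        ≡⟨ cong₂ (λ a b → toℕ (word (a + (2 ^ w ∸ b)))) (μ≋M x (scratch x<)) (μ≋M y (scratch y<)) ⟩
      toℕ (word (M x + (2 ^ w ∸ M y)))  ≡⟨ cong (toℕ ∘ word) (wrap le Mx<) ⟩
      toℕ (word ((M x ∸ M y) + 2 ^ w))
        ≡⟨ Fin.toℕ-fromℕ< (m%n<n _ (2 ^ w) {{m^n≢0 2 w}}) ⟩
      _  ≡⟨ [m+n]%n≡m%n (M x ∸ M y) (2 ^ w) {{m^n≢0 2 w}} ⟩
      _  ≡⟨ Fin.toℕ-fromℕ< (m%n<n (M x ∸ M y) (2 ^ w) {{m^n≢0 2 w}}) ⟨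
      toℕ (word (M x ∸ M y)) ∎)
    write-word : ∀ {s} (μ : Memory w s) d {u v} → word u ≡ word v → write μ d u ≡ write μ d v
    write-word []      d       eq = refl
    write-word (_ ∷ μ) zero    eq = cong (_∷ μ) eq
    write-word (v ∷ μ) (suc d) eq = cong (v ∷_) (write-word μ d eq)
    wrapped : write μ d (read μ x + (2 ^ w ∸ read μ y)) ≋ M [ d ↦ M x ∸ M y ]
    wrapped = subst (_≋ M [ d ↦ M x ∸ M y ]) (sym (write-word μ d word-wrap))
      (write-≋ μ d μ≋M (≤-<-trans (m∸n≤m (M x) (M y)) Mx<))
  trace-steps {code} {n = n} {μ} {M} {M′} (load {d = d} {p} {p<} eq Mp< tr) (s≤s t≤) μ≋M (b ∷ bs) =
    subst (λ c → Reaches code c M′) (sym (steps-step code b bs (config n μ) eq))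
      (trace-steps tr t≤ (subst (λ v → write μ d v ≋ M [ d ↦ M (M p) ])
        (sym (trans (cong (read μ) (μ≋M p (scratch p<))) (μ≋M (M p) Mp<)))
        (write-≋ μ d μ≋M (stored<2^w μ μ≋M (M p) Mp<))) bs)
  trace-steps {code} {n = n} {μ} {M} {M′} (store {p = p} {a} {p<} {a<} eq tr) (s≤s t≤) μ≋M (b ∷ bs) =
    subst (λ c → Reaches code c M′) (sym (steps-step code b bs (config n μ) eq))
      (trace-steps tr t≤ (subst₂ (λ d v → write μ d v ≋ M [ M p ↦ M a ])
        (sym (μ≋M p (scratch p<))) (sym (μ≋M a (scratch a<)))
        (write-≋ μ (M p) μ≋M (stored<2^w μ μ≋M a (scratch a<)))) bs)
  trace-steps {code} {n = n} {μ} {M′ = M′} (jump eq tr) (s≤s t≤) μ≋M (b ∷ bs) =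
    subst (λ c → Reaches code c M′) (sym (steps-step code b bs (config n μ) eq)) (trace-steps tr t≤ μ≋M bs)
  trace-steps {code} {n = n} {μ} {M} {M′} (taken {a = x} {y} {l} {x<} {y<} eq lt tr) (s≤s t≤) μ≋M (b ∷ bs) =
    subst (λ c → Reaches code c M′) (sym (steps-step code b bs (config n μ) eq))
      (subst (λ n → Reaches code (steps code bs (config n μ)) M′) (sym target) (trace-steps tr t≤ μ≋M bs))
    where
    target : (if does (read μ x <? read μ y) then l else suc n) ≡ l
    target = cong (if_then l else suc n) (dec-true (read μ x <? read μ y)
      (subst₂ _<_ (sym (μ≋M x (scratch x<))) (sym (μ≋M y (scratch y<))) lt))
  trace-steps {code} {n = n} {μ} {M} {M′} (missed {a = x} {y} {l} {x<} {y<} eq le tr) (s≤s t≤) μ≋M (b ∷ bs) =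
    subst (λ c → Reaches code c M′) (sym (steps-step code b bs (config n μ) eq))
      (subst (λ n → Reaches code (steps code bs (config n μ)) M′) (sym target) (trace-steps tr t≤ μ≋M bs))
    where
    target : (if does (read μ x <? read μ y) then l else suc n) ≡ suc n
    target = cong (if_then l else suc n) (dec-false (read μ x <? read μ y)
      λ lt → ≤⇒≯ le (subst₂ _<_ (μ≋M x (scratch x<)) (μ≋M y (scratch y<)) lt))

-- The cell 8 + offset u x holds the surplus of label u over the opposite label
-- on x. An observation (x , u) decrements the opposite surplus (pointed to by
-- cell 3) if it is positive, and otherwise increments its own (cell 4).
tallyCode : Code
tallyCode =
    set 5 8
  ∷ set 6 1
  ∷ set 7 0
  ∷ jlt 7 2 7
  ∷ add 3 5 1
  ∷ add 4 3 0
  ∷ jump 9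
  ∷ add 4 5 1
  ∷ add 3 4 0
  ∷ load 5 3
  ∷ jlt 7 5 15
  ∷ load 5 4
  ∷ add 5 5 6
  ∷ store 4 5
  ∷ jump 17
  ∷ sub 5 5 6
  ∷ store 3 5
  ∷ []

-- The counters for + come first, so `base = 8` outputs the categories with a positive surplus of +.
tallyProgram : Program
tallyProgram = record { update = tallyCode ; post = [] ; base = 8 }

-- The invariant of the tallying program

Tallies : ℕ → Set
Tallies N = Fin N → Sign → ℕ

bump : Tallies N → Observation N → Tallies N
bump τ (x , u) x′ u′ = ⟦ does (x Fin.≟ x′) ⟧ * ⟦ does (u Sign.≟ u′) ⟧ + τ x′ u′

bump-self : ∀ (τ : Tallies N) x u → bump τ (x , u) x u ≡ suc (τ x u)
bump-self τ x u rewrite dec-true (x Fin.≟ x) refl | dec-true (u Sign.≟ u) refl = refl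

bump-opposite : ∀ (τ : Tallies N) x u → bump τ (x , u) x (Sign.opposite u) ≡ τ x (Sign.opposite u)
bump-opposite τ x u rewrite dec-true (x Fin.≟ x) refl | dec-false (u Sign.≟ Sign.opposite u) (Sign.s≢opposite[s] u) = refl

bump-other : ∀ (τ : Tallies N) {x x′} u u′ → x ≢ x′ → bump τ (x , u) x′ u′ ≡ τ x′ u′
bump-other τ {x} {x′} u u′ x≢x′ rewrite dec-false (x Fin.≟ x′) x≢x′ = refl

bump≤ : ∀ (τ : Tallies N) o x u → bump τ o x u ≤ suc (τ x u)
bump≤ τ (x , u) x′ u′ = +-monoˡ-≤ (τ x′ u′) (*-mono-≤ (⟦⟧≤1 (does (x Fin.≟ x′))) (⟦⟧≤1 (does (u Sign.≟ u′))))

offset : Sign → Fin N → ℕ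
offset         Sign.+ x = toℕ x
offset {N = N} Sign.- x = toℕ x + N

offset-injective : ∀ u (x : Fin N) u′ x′ → offset u x ≡ offset u′ x′ → u ≡ u′ × x ≡ x′
offset-injective Sign.+ x Sign.+ x′ eq = refl , Fin.toℕ-injective eq
offset-injective {N} Sign.- x Sign.- x′ eq = refl , Fin.toℕ-injective (+-cancelʳ-≡ N (toℕ x) (toℕ x′) eq)
offset-injective {N} Sign.+ x Sign.- x′ eq = contradiction (subst (_< N) eq (Fin.toℕ<n x)) (≤⇒≯ (m≤n+m N (toℕ x′)))
offset-injective {N} Sign.- x Sign.+ x′ eq = contradiction (subst (_< N) (sym eq) (Fin.toℕ<n x′)) (≤⇒≯ (m≤n+m N (toℕ x)))

offset< : ∀ u (x : Fin N) → offset u x < N + N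
offset< {N} Sign.+ x = <-≤-trans (Fin.toℕ<n x) (m≤m+n N N)
offset< {N} Sign.- x = +-monoˡ-< N (Fin.toℕ<n x)

-- `fits` makes room in a word for the addresses, which are below 8 + 2N, and for the counters,
-- which are at most m.
module Tallying (N m w : ℕ) (fits : 8 + (N + N) + m < 2 ^ w) where

  open RAM w
  open Simulation w (N + N)

  size<2^w : size < 2 ^ w
  size<2^w = ≤-<-trans (m≤m+n size m) fits

  m<2^w : m < 2 ^ w
  m<2^w = ≤-<-trans (m≤n+m m size) fits

  small : ∀ {c} → T (c <ᵇ 8) → c < 2 ^ w
  small c<8 = <-trans (scratch c<8) size<2^w

  N<2^w : N < 2 ^ w
  N<2^w = ≤-<-trans (≤-trans (m≤m+n N N) (m≤n+m (N + N) 8)) size<2^w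

  8<2^w : 8 < 2 ^ w
  8<2^w = ≤-<-trans (m≤m+n 8 (N + N)) size<2^w

  address< : ∀ u (x : Fin N) → 8 + offset u x < size
  address< u x = +-monoʳ-< 8 (offset< u x)

  Balanced : Store → ℕ → ℕ → Store → Set
  Balanced M a b M′ =
    (0 < M a × (∀ c → M′ (8 + c) ≡ (M [ a ↦ M a ∸ 1 ]) (8 + c))) ⊎
    (M a ≡ 0 × (∀ c → M′ (8 + c) ≡ (M [ b ↦ suc (M b) ]) (8 + c)))

  balance : ∀ M {a b} → M 3 ≡ 8 + a → M 4 ≡ 8 + b → M 6 ≡ 1 → M 7 ≡ 0 →
            8 + a < size → 8 + b < size → suc (M (8 + b)) < 2 ^ w →
            ∃[ M′ ] (∀ {t} → Trace tallyCode (6 + t) 9 M M′) × M′ 0 ≡ M 0 × Balanced M (8 + a) (8 + b) M′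
  balance M {a} {b} M3 M4 M6 M7 a< b< Mb< with M (8 + a) in Ma
  ... | zero =
    -- The final store is inferred from the trace.
    _ , load refl M3< (missed refl (≤-trans (≤-reflexive M₁5) z≤n) (load refl M4<
          (add refl sum< (store refl (jump refl (halt refl)))))) ,
    cong (λ p → (M₁ [ 5 ↦ v₀ ] [ 5 ↦ v ] [ p ↦ v ]) 0) M4 ,
    inj₂ (refl , λ c → cong₂ (λ p v → (M [ p ↦ v ]) (8 + c)) M4 v≡)
    where
    M₁ = M [ 5 ↦ M (M 3) ]
    v₀ = M₁ (M 4)
    v = v₀ + M 6
    v≡ : v ≡ suc (M (8 + b))
    v≡ = trans (cong₂ _+_ (cong M₁ M4) M6) (+-comm (M (8 + b)) 1)
    M₁5 : M (M 3) ≡ 0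
    M₁5 = trans (cong M M3) Ma
    M3< : M 3 < size
    M3< = subst (_< size) (sym M3) a<
    M4< : M 4 < size
    M4< = subst (_< size) (sym M4) b<
    sum< : v < 2 ^ w
    sum< = subst (_< 2 ^ w) (sym v≡) Mb<
  ... | suc r =
    _ , load refl M3< (taken refl (subst₂ _<_ (sym M7) (sym M₁5) (s≤s z≤n))
          (sub refl (subst₂ _≤_ (sym M6) (sym M₁5) (s≤s z≤n)) (store refl (halt refl)))) ,
    cong (λ p → (M₁ [ 5 ↦ v ] [ p ↦ v ]) 0) M3 ,
    inj₁ (s≤s z≤n , λ c → cong₂ (λ p v → (M [ p ↦ v ]) (8 + c)) M3 (cong₂ _∸_ M₁5 M6))
    where
    M₁ = M [ 5 ↦ M (M 3) ]
    v = M (M 3) ∸ M 6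
    M₁5 : M (M 3) ≡ suc r
    M₁5 = trans (cong M M3) Ma
    M3< : M 3 < size
    M3< = subst (_< size) (sym M3) a<

  -- `universe` lets the program find the counters for -, which lie N cells after those for +.
  -- `bounded` keeps the counters from overflowing.
  record Holds (i : ℕ) (τ : Tallies N) (μ : Memory w size) : Set where
    field
      universe : read μ 0 ≡ N
      surplus  : ∀ u x → read μ (8 + offset u x) ≡ τ x u ∸ τ x (Sign.opposite u)
      bounded  : ∀ x u → τ x u ≤ i

  open Holds

  label : Sign → ℕ
  label Sign.- = 0
  label Sign.+ = 1

  receive-≋ : ∀ (x : Fin N) u μ → receive (x , u) μ ≋ read μ [ 1 ↦ toℕ x ] [ 2 ↦ label u ]
  receive-≋ x Sign.- μ = write-≋ (write μ 1 (toℕ x)) 2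
    (write-≋ μ 1 (λ _ _ → refl) (<-trans (Fin.toℕ<n x) N<2^w)) (small _)
  receive-≋ x Sign.+ μ = write-≋ (write μ 1 (toℕ x)) 2
    (write-≋ μ 1 (λ _ _ → refl) (<-trans (Fin.toℕ<n x) N<2^w)) (small _)

  -- The store when control reaches the balancing part.
  located : Sign → Fin N → Store → Store
  located Sign.- x M = M [ 5 ↦ 8 ] [ 6 ↦ 1 ] [ 7 ↦ 0 ] [ 3 ↦ 8 + toℕ x ] [ 4 ↦ 8 + toℕ x + M 0 ]
  located Sign.+ x M = M [ 5 ↦ 8 ] [ 6 ↦ 1 ] [ 7 ↦ 0 ] [ 4 ↦ 8 + toℕ x ] [ 3 ↦ 8 + toℕ x + M 0 ]

  -- The label swaps the roles of cells 3 and 4. At most 7 instructions precede position 9 and at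
  -- most 6 follow, hence the 13.
  locate : ∀ u x {M M′} → M 0 ≡ N → let M₀ = M [ 1 ↦ toℕ x ] [ 2 ↦ label u ] in
           (∀ {t} → Trace tallyCode (6 + t) 9 (located u x M₀) M′) → Trace tallyCode 13 0 M₀ M′
  locate Sign.- x {M} M0 tr = set refl 8<2^w (set refl (small _) (set refl (small _) (missed refl z≤n
    (add refl (<-trans (address< Sign.+ x) size<2^w) (add refl sum< (jump refl tr))))))
    where
    sum< : 8 + toℕ x + M 0 < 2 ^ w
    sum< rewrite M0 = <-trans (address< Sign.- x) size<2^w
  locate Sign.+ x {M} M0 tr = set refl 8<2^w (set refl (small _) (set refl (small _) (taken refl (s≤s z≤n)
    (add refl (<-trans (address< Sign.+ x) size<2^w) (add refl sum< tr)))))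
    where
    sum< : 8 + toℕ x + M 0 < 2 ^ w
    sum< rewrite M0 = <-trans (address< Sign.- x) size<2^w

  -- Let p and q be the tallies of x for u and its opposite. If p < q, the counter of u stays 0 and
  -- q ∸ p drops by one; if q ≤ p, the opposite counter stays 0 and p ∸ q grows by one.
  updated : ∀ M (τ : Tallies N) x u → (∀ u′ x′ → M (8 + offset u′ x′) ≡ τ x′ u′ ∸ τ x′ (Sign.opposite u′)) →
            ∀ M′ → Balanced M (8 + offset (Sign.opposite u) x) (8 + offset u x) M′ →
            ∀ u′ x′ → M′ (8 + offset u′ x′) ≡ bump τ (x , u) x′ u′ ∸ bump τ (x , u) x′ (Sign.opposite u′)
  updated M τ x u sur M′ bal u′ x′ = result u′ x′ (x Fin.≟ x′) (u Sign.≟ u′)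
    where
    open ≡-Reasoning
    ū = Sign.opposite u
    a = 8 + offset ū x
    b = 8 + offset u x
    p = τ x u
    q = τ x ū
    Ma : M a ≡ q ∸ p
    Ma = trans (sur ū x) (cong (λ v → q ∸ τ x v) (Sign.opposite-selfInverse {u} refl))
    address-injective : ∀ u (x : Fin N) u′ x′ → 8 + offset u x ≡ 8 + offset u′ x′ → u ≡ u′ × x ≡ x′
    address-injective u x u′ x′ eq = offset-injective u x u′ x′ (+-cancelˡ-≡ 8 _ _ eq)
    elsewhere : ∀ u′ (x′ : Fin N) → 8 + offset u′ x′ ≢ a → 8 + offset u′ x′ ≢ b → M′ (8 + offset u′ x′) ≡ M (8 + offset u′ x′)
    elsewhere u′ x′ ≢a ≢b = case bal of λ where
      (inj₁ (_ , eq)) → trans (eq _) (↦-other M _ ≢a)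
      (inj₂ (_ , eq)) → trans (eq _) (↦-other M _ ≢b)
    a≢b : a ≢ b
    a≢b eq = Sign.s≢opposite[s] u (sym (proj₁ (address-injective ū x u x eq)))
    p<q : 0 < M a → p < q
    p<q pos = ≰⇒> λ q≤p → n≮0 (subst (0 <_) (trans Ma (m≤n⇒m∸n≡0 q≤p)) pos)
    q≤p : M a ≡ 0 → q ≤ p
    q≤p zer = m∸n≡0⇒m≤n {q} {p} (trans (sym Ma) zer)
    own : M′ b ≡ suc p ∸ q
    own = case bal of λ where
      (inj₁ (pos , eq)) → begin
        M′ b         ≡⟨ eq (offset u x) ⟩
        (M [ a ↦ M a ∸ 1 ]) b  ≡⟨ ↦-other M _ (a≢b ∘ sym) ⟩
        M b          ≡⟨ sur u x ⟩
        p ∸ q        ≡⟨ m≤n⇒m∸n≡0 (<⇒≤ (p<q pos)) ⟩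
        0            ≡⟨ m≤n⇒m∸n≡0 (p<q pos) ⟨
        suc p ∸ q    ∎
      (inj₂ (zer , eq)) → begin
        M′ b         ≡⟨ eq (offset u x) ⟩
        (M [ b ↦ suc (M b) ]) b  ≡⟨ ↦-same M b _ ⟩
        suc (M b)    ≡⟨ cong suc (sur u x) ⟩
        1 + (p ∸ q)  ≡⟨ +-∸-assoc 1 (q≤p zer) ⟨
        suc p ∸ q    ∎
    opposite : M′ a ≡ q ∸ suc p
    opposite = case bal of λ where
      (inj₁ (pos , eq)) → begin
        M′ a         ≡⟨ eq (offset ū x) ⟩
        (M [ a ↦ M a ∸ 1 ]) a  ≡⟨ ↦-same M a _ ⟩
        M a ∸ 1      ≡⟨ cong (_∸ 1) Ma ⟩
        q ∸ p ∸ 1    ≡⟨ ∸-+-assoc q p 1 ⟩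
        q ∸ (p + 1)  ≡⟨ cong (q ∸_) (+-comm p 1) ⟩
        q ∸ suc p    ∎
      (inj₂ (zer , eq)) → begin
        M′ a         ≡⟨ eq (offset ū x) ⟩
        (M [ b ↦ suc (M b) ]) a  ≡⟨ ↦-other M _ a≢b ⟩
        M a          ≡⟨ zer ⟩
        0            ≡⟨ m≤n⇒m∸n≡0 (m≤n⇒m≤1+n (q≤p zer)) ⟨
        q ∸ suc p    ∎
    opposite-≢ : ∀ u u′ → u ≢ u′ → u′ ≡ Sign.opposite u
    opposite-≢ Sign.- Sign.- ≢ = contradiction refl ≢
    opposite-≢ Sign.- Sign.+ ≢ = refl
    opposite-≢ Sign.+ Sign.- ≢ = refl
    opposite-≢ Sign.+ Sign.+ ≢ = contradiction refl ≢
    result : ∀ u′ x′ → Dec (x ≡ x′) → Dec (u ≡ u′) →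
      M′ (8 + offset u′ x′) ≡ bump τ (x , u) x′ u′ ∸ bump τ (x , u) x′ (Sign.opposite u′)
    result u′ x′ (no x≢x′) _ = begin
      M′ (8 + offset u′ x′)
        ≡⟨ elsewhere u′ x′ (x≢x′ ∘ sym ∘ proj₂ ∘ address-injective u′ x′ ū x) (x≢x′ ∘ sym ∘ proj₂ ∘ address-injective u′ x′ u x) ⟩
      M (8 + offset u′ x′)   ≡⟨ sur u′ x′ ⟩
      τ x′ u′ ∸ τ x′ (Sign.opposite u′)
        ≡⟨ cong₂ _∸_ (bump-other τ u u′ x≢x′) (bump-other τ u (Sign.opposite u′) x≢x′) ⟨
      bump τ (x , u) x′ u′ ∸ bump τ (x , u) x′ (Sign.opposite u′) ∎
    result u′ x′ (yes refl) (yes refl) =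
      trans own (sym (cong₂ _∸_ (bump-self τ x u) (bump-opposite τ x u)))
    result u′ x′ (yes refl) (no u≢u′) with refl ← opposite-≢ u u′ u≢u′ =
      trans opposite (sym (cong₂ _∸_ (bump-opposite τ x u)
        (trans (cong (bump τ (x , u) x) (Sign.opposite-selfInverse {u} refl)) (bump-self τ x u))))

  update-holds : ∀ {i τ μ} → Holds i τ μ → i < m → ∀ obs {t} → 13 ≤ t → (coins : Vec Bool t) →
    let c = exec tallyCode coins (receive obs μ) in
    fetch tallyCode (pc c) ≡ nothing × Holds (suc i) (bump τ obs) (mem c)
  update-holds {i} {τ} {μ} holds i<m (x , u) 13≤t coins =
    let M = located u x (read μ [ 1 ↦ toℕ x ] [ 2 ↦ label u ])
        M′ , trace , M′0 , balanced = balance M (proj₁ (pointers u)) (proj₂ (pointers u)) (one u) (zer u)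
          (address< (Sign.opposite u) x) (address< u x) (counter u)
        halted , ≋M′ = trace-steps (locate u x (universe holds) trace) 13≤t (receive-≋ x u μ) coins
    in halted , record
      { universe = trans (≋M′ 0 (scratch _)) (trans M′0 (trans (cell0 u) (universe holds)))
      ; surplus  = λ u′ x′ → trans (≋M′ _ (address< u′ x′))
          (updated M τ x u (λ u″ x″ → trans (untouched u _) (surplus holds u″ x″)) M′ balanced u′ x′)
      ; bounded  = λ x′ u′ → ≤-trans (bump≤ τ (x , u) x′ u′) (s≤s (bounded holds x′ u′))
      }
    where
    M₀ : Sign → Store
    M₀ u = located u x (read μ [ 1 ↦ toℕ x ] [ 2 ↦ label u ])
    shift : 8 + toℕ x + read μ 0 ≡ 8 + offset Sign.- x
    shift = cong (8 + toℕ x +_) (universe holds)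
    pointers : ∀ u → M₀ u 3 ≡ 8 + offset (Sign.opposite u) x × M₀ u 4 ≡ 8 + offset u x
    pointers Sign.- = refl , shift
    pointers Sign.+ = shift , refl
    one : ∀ u → M₀ u 6 ≡ 1
    one Sign.- = refl
    one Sign.+ = refl
    zer : ∀ u → M₀ u 7 ≡ 0
    zer Sign.- = refl
    zer Sign.+ = refl
    cell0 : ∀ u → M₀ u 0 ≡ read μ 0
    cell0 Sign.- = refl
    cell0 Sign.+ = refl
    untouched : ∀ u c → M₀ u (8 + c) ≡ read μ (8 + c)
    untouched Sign.- c = refl
    untouched Sign.+ c = refl
    counter : ∀ u → suc (M₀ u (8 + offset u x)) < 2 ^ w
    counter u = ≤-<-trans (s≤s (begin
      M₀ u (8 + offset u x)           ≡⟨ trans (untouched u _) (surplus holds u x) ⟩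
      τ x u ∸ τ x (Sign.opposite u)   ≤⟨ m∸n≤m (τ x u) (τ x (Sign.opposite u)) ⟩
      τ x u                           ≤⟨ bounded holds x u ⟩
      i ∎)) (≤-<-trans i<m m<2^w)
      where open ≤-Reasoning

  start-holds : Holds 0 (λ _ _ → 0) (start size N)
  start-holds = record
    { universe = read-start {size} N<2^w (scratch _)
    ; surplus  = λ u x → read-start-suc size N (7 + offset u x)
    ; bounded  = λ _ _ → z≤n
    }

  module _ {t : ℕ} (13≤t : 13 ≤ t) where

    reachable-holds : ∀ {i μ} → i ≤ m → Reachable tallyProgram N m w size t i μ → ∃[ τ ] Holds i τ μ
    reachable-holds _   initial               = _ , start-holds
    reachable-holds i<m (next r obs coins) =
      _ , proj₂ (update-holds (proj₂ (reachable-holds (<⇒≤ i<m) r)) i<m obs 13≤t coins)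

    updateTime : UpdateTime tallyProgram N m w size t
    updateTime i<m r obs coins = proj₁ (update-holds (proj₂ (reachable-holds (<⇒≤ i<m) r)) i<m obs 13≤t coins)

    -- Starts from arbitrary tallies and an arbitrary i, so that the induction can peel off the
    -- first observation.
    process : ∀ {l} (xs : Stream N l) (tosses : Fin l → Vec Bool t) {i τ μ} → Holds i τ μ → i + l ≤ m →
      Holds (i + l) (λ x u → tally xs x u + τ x u)
        (List.foldl (λ μ j → mem (exec tallyCode (tosses j) (receive (lookup xs j) μ))) μ (allFin l))
    process {l} [] tosses {i} holds _ = subst (λ i → Holds i _ _) (sym (+-identityʳ i)) holds
    process {suc l} (o ∷ xs) tosses {i} {τ} {μ} holds i+l≤m =
      subst (Holds (i + suc l) _) (trans (sym (List.foldl-map F suc _ (allFin l)))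
          (cong (List.foldl F (F μ zero)) (List.map-tabulate id suc)))
        (record { universe = universe rest
                ; surplus  = λ u x → trans (surplus rest u x) (cong₂ _∸_ (reassociate x u) (reassociate x (Sign.opposite u)))
                ; bounded  = λ x u → subst₂ _≤_ (reassociate x u) (sym (+-suc i l)) (bounded rest x u) })
      where
      F : Memory w size → Fin (suc l) → Memory w size
      F μ j = mem (exec tallyCode (tosses j) (receive (lookup (o ∷ xs) j) μ))
      i<m : i < m
      i<m = ≤-trans (m≤m+n (suc i) l) (≤-trans (≤-reflexive (sym (+-suc i l))) i+l≤m)
      rest : Holds (suc i + l) (λ x u → tally xs x u + bump τ o x u)
               (List.foldl (λ μ j → F μ (suc j)) (F μ zero) (allFin l))
      rest = process xs (tosses ∘ suc) (proj₂ (update-holds holds i<m o 13≤t (tosses zero)))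
        (≤-trans (≤-reflexive (sym (+-suc i l))) i+l≤m)
      reassociate : ∀ x u → tally xs x u + bump τ o x u ≡ tally (o ∷ xs) x u + τ x u
      reassociate x u = shuffle (tally xs x u) _ (τ x u)
        where
        shuffle : ∀ a b c → a + (b + c) ≡ b + a + c
        shuffle = solve-∀

    onePass-majority : ∀ (xs : Stream N m) T tosses final →
      Majority xs (run (withCoins tallyProgram N m w size t T tosses final) xs)
    onePass-majority xs T tosses final x = begin
      lookup (selected N 8 (mem (exec [] final μ))) x
        ≡⟨ Vec.lookup∘tabulate _ x ⟩
      0 <ᵇ read (mem (exec [] final μ)) (8 + toℕ x)
        ≡⟨ cong (λ c → 0 <ᵇ read (mem c) (8 + toℕ x)) (steps-halted [] final (config 0 μ) refl) ⟩
      0 <ᵇ read μ (8 + toℕ x)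
        ≡⟨ cong (0 <ᵇ_) (trans (surplus processed Sign.+ x) (cong₂ _∸_ (+-identityʳ (tally xs x Sign.+)) (+-identityʳ (tally xs x Sign.-)))) ⟩
      0 <ᵇ (tally xs x Sign.+ ∸ tally xs x Sign.-)
        ≡⟨ <ᵇ-∸ (tally xs x Sign.-) (tally xs x Sign.+) ⟩
      tally xs x Sign.- <ᵇ tally xs x Sign.+ ∎
      where
      open ≡-Reasoning
      μ = List.foldl (λ μ j → mem (exec tallyCode (lookup tosses j) (receive (lookup xs j) μ))) (start size N) (allFin m)
      processed : Holds m (λ x u → tally xs x u + 0) μ
      processed = process xs (lookup tosses) start-holds ≤-refl
      <ᵇ-∸ : ∀ a b → (0 <ᵇ (b ∸ a)) ≡ (a <ᵇ b)
      <ᵇ-∸ zero    b       = refl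
      <ᵇ-∸ (suc a) zero    = refl
      <ᵇ-∸ (suc a) (suc b) = <ᵇ-∸ a b

-- The two bounds

n<2^[1+⌊log₂n⌋] : ∀ n → n < 2 ^ (1 + ⌊log₂ n ⌋)
n<2^[1+⌊log₂n⌋] n = ≰⇒> λ 2^≤n → <-irrefl refl
  (≤-trans (≤-reflexive (sym (⌊log₂[2^n]⌋≡n (1 + ⌊log₂ n ⌋)))) (⌊log₂⌋-mono-≤ 2^≤n))

-- The left side is below 16 (N + m + 1). One word length W covers N + m + 1 and four more cover 16
-- = 2^4, hence the 5.
memory-fits : ∀ N m → 8 + (N + N) + m < 2 ^ wordSize 5 N m
memory-fits N m = begin-strict
  8 + (N + N) + m        <⟨ m<m+n (8 + (N + N) + m) {8 + (14 * N + 15 * m)} (s≤s z≤n) ⟩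
  8 + (N + N) + m + (8 + (14 * N + 15 * m))  ≡⟨ regroup N m ⟩
  suc (N + m) * 2 ^ 4    ≤⟨ *-mono-≤ (n<2^[1+⌊log₂n⌋] (N + m)) (^-monoʳ-≤ 2 (m≤m*n 4 W)) ⟩
  2 ^ W * 2 ^ (4 * W)    ≡⟨ ^-distribˡ-+-* 2 W (4 * W) ⟨
  2 ^ (5 * W) ∎
  where
  open ≤-Reasoning
  W = 1 + ⌊log₂ (N + m) ⌋
  regroup : ∀ N m → 8 + (N + N) + m + (8 + (14 * N + 15 * m)) ≡ (1 + (N + m)) * 16
  regroup = solve-∀

-- For positive N and m, N + m ≤ 2 N m, so the logarithm of the sum is at most that of the product
-- up to a constant; and 4 + a + b ≤ 4 (1 + a) (1 + b).
⌊log₂⌋-+ : ∀ N m .{{_ : NonZero N}} .{{_ : NonZero m}} →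
           1 + ⌊log₂ (N + m) ⌋ ≤ 4 * ((1 + ⌊log₂ N ⌋) * (1 + ⌊log₂ m ⌋))
⌊log₂⌋-+ N m = begin
  1 + ⌊log₂ (N + m) ⌋  ≤⟨ s≤s (⌊log₂⌋-mono-≤ N+m≤) ⟩
  1 + ⌊log₂ (2 ^ (1 + ((1 + a) + (1 + b)))) ⌋  ≡⟨ cong suc (⌊log₂[2^n]⌋≡n (1 + ((1 + a) + (1 + b)))) ⟩
  2 + ((1 + a) + (1 + b))  ≤⟨ m≤m+n _ (3 * a + 3 * b + 4 * (a * b)) ⟩
  2 + ((1 + a) + (1 + b)) + (3 * a + 3 * b + 4 * (a * b))  ≡⟨ expand a b ⟩
  4 * ((1 + a) * (1 + b)) ∎
  where
  open ≤-Reasoning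
  a = ⌊log₂ N ⌋
  b = ⌊log₂ m ⌋
  expand : ∀ a b → 2 + ((1 + a) + (1 + b)) + (3 * a + 3 * b + 4 * (a * b)) ≡ 4 * ((1 + a) * (1 + b))
  expand = solve-∀
  N+m≤ : N + m ≤ 2 ^ (1 + ((1 + a) + (1 + b)))
  N+m≤ = begin
    N + m                          ≤⟨ +-mono-≤ (m≤m*n N m) (m≤n*m m N) ⟩
    N * m + N * m                  ≡⟨ cong (N * m +_) (+-identityʳ (N * m)) ⟨
    2 * (N * m)                    ≤⟨ *-monoʳ-≤ 2 (*-mono-≤ (<⇒≤ (n<2^[1+⌊log₂n⌋] N)) (<⇒≤ (n<2^[1+⌊log₂n⌋] m))) ⟩
    2 * (2 ^ (1 + a) * 2 ^ (1 + b)) ≡⟨ cong (2 *_) (^-distribˡ-+-* 2 (1 + a) (1 + b)) ⟨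
    2 ^ (1 + ((1 + a) + (1 + b))) ∎

-- At most 10 N cells of 5 · 4 · l bits each, the 4 being that of `⌊log₂⌋-+`.
space : ∀ N m .{{_ : NonZero N}} .{{_ : NonZero m}} →
        (8 + (N + N)) * wordSize 5 N m ≤ 200 * N * polylog 1 N m
space N m = begin
  (8 + (N + N)) * (5 * (1 + ⌊log₂ (N + m) ⌋))
    ≤⟨ *-mono-≤ (+-monoˡ-≤ (N + N) (m≤m*n 8 N)) (*-monoʳ-≤ 5 (⌊log₂⌋-+ N m)) ⟩
  (8 * N + (N + N)) * (5 * (4 * l))  ≡⟨ regroup N l ⟩
  200 * N * l                         ≡⟨ cong (200 * N *_) (*-identityʳ l) ⟨
  200 * N * polylog 1 N m ∎
  where
  open ≤-Reasoning
  l = (1 + ⌊log₂ N ⌋) * (1 + ⌊log₂ m ⌋)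
  regroup : ∀ N l → (8 * N + (N + N)) * (5 * (4 * l)) ≡ 200 * N * l
  regroup = solve-∀

fromℕ-*-≤ : ∀ a b {ε} → ε ℚ.< 1ℚ → a ≤ b → fromℕ a ℚ.* ε ℚ.≤ fromℕ b
fromℕ-*-≤ a b {ε} ε<1 a≤b = begin
  fromℕ a ℚ.* ε    ≤⟨ ℚ.*-monoˡ-≤-nonNeg (fromℕ a) {{ℚ.normalize-nonNeg a 1}} (ℚ.<⇒≤ ε<1) ⟩
  fromℕ a ℚ.* 1ℚ   ≡⟨ ℚ.*-identityʳ (fromℕ a) ⟩
  fromℕ a          ≤⟨ /-mono-≤ a b (*-monoˡ-≤ 1 a≤b) ⟩
  fromℕ b          ∎
  where open ℚ.≤-Reasoning

Pr-all : ∀ {P : Pred A 0ℓ} (as : List⁺ A) (P? : Decidable P) → ListAll.All P (toList as) → ℤ.+ 2 / 3 ℚ.≤ Pr as P?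
Pr-all as P? all = /-mono-≤ 2 (length (List.filter P? (toList as))) (begin
  2 * List⁺.length as  ≤⟨ *-monoˡ-≤ (List⁺.length as) (m≤m+n 2 1) ⟩
  3 * List⁺.length as  ≡⟨ *-comm 3 (List⁺.length as) ⟩
  List⁺.length as * 3  ≡⟨ cong (λ xs → length xs * 3) (List.filter-all P? all) ⟨
  length (List.filter P? (toList as)) * 3 ∎)
  where open ≤-Reasoning

All-concatMap : ∀ {P : Pred B 0ℓ} (f : A → List⁺ B) as → (∀ a → ListAll.All P (toList (f a))) →
                ListAll.All P (toList (List⁺.concatMap f as))
All-concatMap f (a ∷ as) all = ListAll.++⁺ (all a)
  (ListAll.concat⁺ (ListAll.map⁺ (ListAll.map⁺ (ListAll.universal all as))))

All-map : ∀ {P : Pred B 0ℓ} (f : A → B) as → (∀ a → P (f a)) → ListAll.All P (toList (List⁺.map f as))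
All-map f (a ∷ as) all = all a ListAll.∷ ListAll.map⁺ (ListAll.universal all as)

p≤p+q : ∀ p {q} → 0ℚ ℚ.< q → p ℚ.≤ p ℚ.+ q
p≤p+q p {q} 0<q = subst (ℚ._≤ p ℚ.+ q) (ℚ.+-identityʳ p) (ℚ.+-monoʳ-≤ p (ℚ.<⇒≤ 0<q))

-- Every outcome of the coins attains OPT, so the event has probability 1.
withinError-all : ∀ {N m passes w s} .{{_ : NonZero m}} (𝒜 : Randomized (Observation N) (Subset N) m passes w s) {ε} →
  0ℚ ℚ.< ε → (∀ xs → ListAll.All (λ alg → Majority xs (run alg xs)) (toList 𝒜)) → WithinError 𝒜 ε
withinError-all {N} {m} {passes} {w} {s} 𝒜 {ε} 0<ε all xs = Pr-all 𝒜 close? (ListAll.map (λ {alg} → close alg) (all xs))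
  where
  Close : Deterministic (Observation N) (Subset N) m passes w s → Set
  Close alg = L xs (run alg xs) ℚ.≤ OPT xs ℚ.+ ε
  close? : Decidable Close
  close? alg = L xs (run alg xs) ℚ.≤? (OPT xs ℚ.+ ε)
  close : ∀ alg → Majority xs (run alg xs) → Close alg
  close alg maj = ℚ.≤-trans (L-majority xs {run alg xs} maj) (p≤p+q (OPT xs) 0<ε)

module _ {N m w : ℕ} (fits : 8 + (N + N) + m < 2 ^ w) where
  open Tallying N m w fits

  onePass-all : ∀ {t} → 13 ≤ t → ∀ T (xs : Stream N m) →
    ListAll.All (λ alg → Majority xs (run alg xs)) (toList (onePass tallyProgram N m w (8 + (N + N)) t T))
  onePass-all {t} 13≤t T xs =
    All-concatMap (λ tosses → List⁺.map (withCoins′ tosses) (tossesFor T)) (vectors (tossesFor t) m) λ tosses →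
      All-map (withCoins′ tosses) (tossesFor T) λ final → onePass-majority 13≤t xs T tosses final
    where
    withCoins′ = withCoins tallyProgram N m w (8 + (N + N)) t T
    tossesFor = coinTosses tallyProgram N m w (8 + (N + N)) t T

algorithm : (ε : ℚ) → 0ℚ ℚ.< ε → ε ℚ.< 1ℚ →
  Σ[ P ∈ Program ] ((N m : ℕ) .{{_ : NonZero N}} .{{_ : NonZero m}} →
    ∃[ s ]
      ( fromℕ (s * wordSize 5 N m) ℚ.* ε ℚ.≤ fromℕ (200 * N * polylog 1 N m)
      × UpdateTime P N m (wordSize 5 N m) s 200
      × PostTime P N m (wordSize 5 N m) s 200 (200 * 2 ^ N)
      × WithinError (onePass P N m (wordSize 5 N m) s 200 (200 * 2 ^ N)) ε ))
algorithm ε 0<ε ε<1 = tallyProgram , λ N m → 8 + (N + N)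
  , fromℕ-*-≤ ((8 + (N + N)) * wordSize 5 N m) (200 * N * polylog 1 N m) ε<1 (space N m)
  , Tallying.updateTime N m (wordSize 5 N m) (memory-fits N m) (m≤m+n 13 187)
  , (λ {μ} _ coins → cong (λ c → RAM.fetch (wordSize 5 N m) [] (RAM.Config.pc c))
      (Simulation.steps-halted (wordSize 5 N m) (N + N) [] coins (RAM.config 0 μ) refl))
  , withinError-all (onePass tallyProgram N m (wordSize 5 N m) (8 + (N + N)) 200 (200 * 2 ^ N)) 0<ε
      (onePass-all (memory-fits N m) (m≤m+n 13 187) (200 * 2 ^ N))

-- The sizes come as equations, so that matching them makes 𝒜 an algorithm on the encoded streams.
lower-bound : ∀ {passes N m w s k n′ e r} .{{_ : NonZero m}} .{{_ : NonZero n′}} → k ≡ 49 * n′ →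
  (∀ (F : Vec Bool k → Vec Bool k → Bool) rs → (∀ x y → rs covers x , y ≡ ⟦ F x y ⟧) →
    length rs ≡ 2 ^ (2 * passes * (s * w)) → accepted F false ≤ accepted F true + 16 * (n′ * cube k)) →
  (𝒜 : Randomized (Observation N) Bool m passes w s) → DecidesOPT≡0 𝒜 → suc k + e ≡ N → k + (k + r) ≡ m → ⊥
lower-bound {passes} {w = w} {s} {k} {n′} {e} {r} k≡ corrupt 𝒜 decides refl refl =
  no-small-space {passes} {w} {s} {e} {r} {k} {n′} k≡ corrupt 𝒜 decides

theorem3 :
    -- The memory bound is s * w ≤ C * (N / ε) * polylog, cleared of the division by ε.
    (∃[ C ] ∃[ c ] ∃[ k ]
    ((ε : ℚ) → 0ℚ ℚ.< ε → ε ℚ.< 1ℚ →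
    Σ[ P ∈ Program ]
    ((N m : ℕ) .{{_ : NonZero N}} .{{_ : NonZero m}} →
    ∃[ s ]
    ( fromℕ (s * wordSize c N m) ℚ.* ε ℚ.≤ fromℕ (C * N * polylog k N m)
    × UpdateTime P N m (wordSize c N m) s C
    × PostTime P N m (wordSize c N m) s C (C * 2 ^ N)
    × WithinError (onePass P N m (wordSize c N m) s C (C * 2 ^ N)) ε ))))
    ×
    ((passes : ℕ) →
    ∃[ d ] ∃[ N₀ ] ∃[ k ]
    ((N m w s : ℕ) .{{_ : NonZero m}} → N₀ ≤ N → d * N ≤ m →
    (𝒜 : Randomized (Observation N) Bool m passes w s) →
    DecidesOPT≡0 𝒜 →
    N ≤ k * (s * w)))
theorem3 = (200 , 5 , 1 , algorithm) , λ passes → 2 , 49 * 70 * 6 + 1 , 49 * 70 * (2 * passes + 6) , bound passes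
  where
  bound : ∀ passes (N m w s : ℕ) .{{_ : NonZero m}} → 49 * 70 * 6 + 1 ≤ N → 2 * N ≤ m →
    (𝒜 : Randomized (Observation N) Bool m passes w s) → DecidesOPT≡0 𝒜 → N ≤ 49 * 70 * (2 * passes + 6) * (s * w)
  bound passes N m w s {{m≢0}} N₀≤N 2N≤m 𝒜 decides = ≮⇒≥ λ many →
    -- There are 2^(2 · passes · s · w) rectangles; the 6 is the slack that absorbs the factor 49.
    -- Each half of the stream takes k < N observations, so `2 * N ≤ m` leaves room for both.
    let q = 2 * passes * (s * w) + 6
        k = 49 * (70 * q)
        k<N = ≤-<-trans (≤-reflexive (sym (*-assoc 49 70 q))) (blocks< (49 * 70) (s * w) N₀≤N many)
        e , N≡ = m≤n⇒∃[o]m+o≡n k<N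
        r , m≡ = m≤n⇒∃[o]m+o≡n (≤-trans (+-mono-≤ (<⇒≤ k<N) (<⇒≤ k<N))
          (≤-trans (≤-reflexive (cong (N +_) (sym (+-identityʳ N)))) 2N≤m))
    in lower-bound {n′ = 70 * q} {{m≢0}} {{m*n≢0 70 q {{_}} {{>-nonZero {q} (≤-trans (s≤s z≤n) (m≤n+m 6 (2 * passes * (s * w))))}}}} refl
         (few-rectangles-corruption {q} ≤-refl) 𝒜 decides N≡ (trans (sym (+-assoc k k r)) m≡)
    where
    -- Without any memory, `many` only says that N is positive, and the threshold on N provides the
    -- room for the additive 6. Otherwise 6 ≤ 6 · l, which is why 6 appears in the factor of the
    -- bound.
    blocks< : ∀ K l → K * 6 + 1 ≤ N → K * (2 * passes + 6) * l < N → K * (2 * passes * l + 6) < N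
    blocks< K zero    N₀≤N _    = ≤-trans (≤-reflexive (trans
      (cong (λ z → suc (K * (z + 6))) (*-zeroʳ (2 * passes))) (+-comm 1 (K * 6)))) N₀≤N
    blocks< K (suc l) _    many = ≤-<-trans (begin
      K * (2 * passes * suc l + 6)          ≤⟨ *-monoʳ-≤ K (+-monoʳ-≤ (2 * passes * suc l) (m≤m*n 6 (suc l))) ⟩
      K * (2 * passes * suc l + 6 * suc l)  ≡⟨ cong (K *_) (*-distribʳ-+ (suc l) (2 * passes) 6) ⟨
      K * ((2 * passes + 6) * suc l)        ≡⟨ *-assoc K (2 * passes + 6) (suc l) ⟨
      K * (2 * passes + 6) * suc l          ∎) many
      where open ≤-Reasoning
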